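{- Let $p$ be an odd prime, let $\mathcal{S}$ be the affine surface over $\mathbb{F}_{p^2}$ given by $y^p-y=x^{p+1}z^2+x^2z^{p+1}$, let $T=\{(x,y,z)\in\mathcal{S}(\mathbb{F}_{p^2}): z\ne 0\}$, and for integers $2\le\rho_1,\rho_2\le p$ let $$V_{\rho_1,\rho_2}=\langle x^iy^jz^k: 0\le i\le p-\rho_1,\ 0\le j\le p-\rho_2,\ 0\le k\le p^2-2p\rangle.$$ Then the evaluation code $C=C(V_{\rho_1,\rho_2},T)$ has hierarchical locality, where for the position of a point $P_i=(a,b,c)\in T$ the lower code is the puncturing of $C$ to the fiber $\{(a,b+\delta,c):\delta\in\mathbb{F}_p\}$ and the middle code is the puncturing of $C$ to the points of $T$ with $z$-coordinate $c$. Specifically: (1) each lower code has length $n_2=p$, dimension at most $s_2=p-\rho_2+1$, and minimum distance at least $d_2=\rho_2$; (2) each middle code has length $n_1\le 2p^2-p$, dimension at most $s_1=(p-\rho_2+1)(p-\rho_1+1)$, and minimum distance at least $d_1=\rho_1\rho_2$; (3) the full code has length $n=2p^4-3p^3+2p^2-p$, dimension $k=(p-\rho_2+1)(p-\rho_1+1)(p^2-2p+1)$, and minimum distance $d\ge(\rho_1+\rho_2-3)p+(\rho_1+\rho_2)$.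
   Context: For an ordered finite set $T=\{P_1,\dots,P_n\}$ of points and a vector space $V$ of polynomials, the evaluation code is $C(V,T)=\{(g(P_1),\dots,g(P_n)):g\in V\}$. The puncturing of a code to a set of positions is the projection of all codewords onto those positions. Length, dimension, and minimum (Hamming) distance are the usual linear-code parameters. -}

module Defs where

open import Algebra.Apartness.Bundles using (HeytingCommutativeRing; HeytingField)
open import Algebra.Bundles using (CommutativeRing)
import Algebra.Properties.Semiring.Exp as Exp
import Algebra.Properties.Semiring.Mult as Mult
import Algebra.Properties.Semiring.Sum as Sum
open import Data.Fin using (Fin; toℕ)
open import Data.Fin.Properties using (any?) renaming (_≟_ to _≟ᶠ_)
open import Data.List using (List; foldr; length; filter; allFin; lookup)
open import Data.List.Relation.Unary.All using (All)
open import Data.Nat as ℕ using (ℕ; _≤_; _∸_)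
open import Data.Product using (Σ; ∃; _×_; _,_; proj₁; proj₂)
open import Data.Product.Relation.Binary.Pointwise.NonDependent using (_×ₛ_; ×-decidable)
open import Data.Vec.Functional using (Vector)
import Data.Vec.Functional.Relation.Binary.Equality.Setoid as VecEquality
open import Function using (_∘_; Inverse)
open import Function.Properties.Inverse using (Inverse⇒Injection)
open import Level using (Level; 0ℓ; _⊔_; suc)
open import Relation.Binary using (Setoid)
import Relation.Binary.Construct.On as On
import Relation.Binary.Definitions as B
open import Relation.Binary.PropositionalEquality as ≡ using (_≡_)
open import Relation.Nullary using (¬_)
open import Relation.Nullary.Decidable using (¬?; via-injection)
open import Relation.Unary using (Pred; Decidable; _∈_; _⊆_)

record FiniteField (c ℓ₁ ℓ₂ : Level) (q : ℕ) : Set (suc (c ⊔ ℓ₁ ⊔ ℓ₂)) where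
  field
    heytingField : HeytingField c ℓ₁ ℓ₂
    enumeration  : Inverse (HeytingField.setoid heytingField) (≡.setoid (Fin q))

  open HeytingField heytingField public
    using (Carrier; _≈_; _+_; _*_; _-_; 0#; 1#; setoid; heytingCommutativeRing)
  open HeytingCommutativeRing heytingCommutativeRing public using (commutativeRing)
  open CommutativeRing commutativeRing public using (semiring)

  infix 4 _≟_
  _≟_ : B.Decidable _≈_
  _≟_ = via-injection (Inverse⇒Injection enumeration) _≟ᶠ_

module Codes {c ℓ₁ ℓ₂ : Level} {q : ℕ} (F : FiniteField c ℓ₁ ℓ₂ q) where

  open FiniteField F
  open Sum semiring using (sum)
  open VecEquality setoid using (_≋_)

  Word : ℕ → Set c
  Word n = Vector Carrier n

  Code : ℕ → Set (suc (c ⊔ ℓ₁))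
  Code n = Pred (Word n) (c ⊔ ℓ₁)

  hammingDistance : ∀ {n} → Word n → Word n → ℕ
  hammingDistance {n} u v = length (filter (λ i → ¬? (u i ≟ v i)) (allFin n))

  IsMinimumDistance : ∀ {n} → Code n → ℕ → Set (c ⊔ ℓ₁)
  IsMinimumDistance C d =
    (∃ λ u → ∃ λ v → u ∈ C × v ∈ C × ¬ (u ≋ v) × hammingDistance u v ≡ d)
    × (∀ u v → u ∈ C → v ∈ C → ¬ (u ≋ v) → d ≤ hammingDistance u v)

  linearCombination : ∀ {n k} → Vector Carrier k → Vector (Word n) k → Word n
  linearCombination a b i = sum (λ j → a j * b j i)

  LinearlyIndependent : ∀ {n k} → Vector (Word n) k → Set (c ⊔ ℓ₁)
  LinearlyIndependent b =
    ∀ a → linearCombination a b ≋ (λ _ → 0#) → ∀ j → a j ≈ 0#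

  record IsBasis {n k : ℕ} (C : Code n) (b : Vector (Word n) k) : Set (c ⊔ ℓ₁) where
    field
      inCode      : ∀ j → b j ∈ C
      independent : LinearlyIndependent b
      spanning    : ∀ w → w ∈ C → ∃ λ a → w ≋ linearCombination a b

  HasDimension : ∀ {n} → Code n → ℕ → Set (c ⊔ ℓ₁)
  HasDimension {n} C k = ∃ λ (b : Vector (Word n) k) → IsBasis C b

  DimensionAtMost : ∀ {n} → Code n → ℕ → Set (c ⊔ ℓ₁)
  DimensionAtMost C s = ∃ λ k → HasDimension C k × k ≤ s

  MinimumDistanceAtLeast : ∀ {n} → Code n → ℕ → Set (c ⊔ ℓ₁)
  MinimumDistanceAtLeast C d = ∃ λ m → IsMinimumDistance C m × d ≤ m

  positions : ∀ {n ℓ} {S : Pred (Fin n) ℓ} → Decidable S → List (Fin n)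
  positions {n} S? = filter S? (allFin n)

  puncture : ∀ {n ℓ} {S : Pred (Fin n) ℓ} →
             Code n → (S? : Decidable S) → Code (length (positions S?))
  puncture C S? w = ∃ λ u → u ∈ C × w ≋ (u ∘ lookup (positions S?))

  -- Two-level hierarchical locality, with the middle and lower codes of each
  -- position given by specified sets of positions.  By `nested`, the lower
  -- code at every position of a middle code is also a puncturing of that
  -- middle code.
  record HierarchicalLocality
    {n : ℕ} {ℓ : Level} (C : Code n)
    {Middle : Fin n → Pred (Fin n) ℓ} (middle? : ∀ i → Decidable (Middle i))
    {Lower  : Fin n → Pred (Fin n) ℓ} (lower?  : ∀ i → Decidable (Lower i))
    (n₁ s₁ d₁ n₂ s₂ d₂ : ℕ) : Set (c ⊔ ℓ₁ ⊔ ℓ) where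
    field
      ∈middle        : ∀ i → i ∈ Middle i
      ∈lower         : ∀ i → i ∈ Lower i
      nested         : ∀ {i j} → j ∈ Middle i → Lower j ⊆ Middle i
      middleLength   : ∀ i → length (positions (middle? i)) ≤ n₁
      middleDim      : ∀ i → DimensionAtMost (puncture C (middle? i)) s₁
      middleDistance : ∀ i → MinimumDistanceAtLeast (puncture C (middle? i)) d₁
      lowerLength    : ∀ i → length (positions (lower? i)) ≤ n₂
      lowerDim       : ∀ i → DimensionAtMost (puncture C (lower? i)) s₂
      lowerDistance  : ∀ i → MinimumDistanceAtLeast (puncture C (lower? i)) d₂

module Evaluation {c ℓ₁ ℓ₂ : Level} {q : ℕ} (F : FiniteField c ℓ₁ ℓ₂ q) where

  open FiniteField F
  open Exp semiring using (_^_)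
  open VecEquality setoid using (_≋_)
  open Codes F using (Code)

  Point : Set c
  Point = Carrier × Carrier × Carrier

  pointSetoid : Setoid c ℓ₁
  pointSetoid = setoid ×ₛ (setoid ×ₛ setoid)

  open Setoid pointSetoid public using () renaming (_≈_ to _≈ₚ_)

  _≟ₚ_ : B.Decidable _≈ₚ_
  _≟ₚ_ = ×-decidable _≟_ (×-decidable _≟_ _≟_)

  Monomial : Set
  Monomial = ℕ × ℕ × ℕ

  -- A polynomial is given by a formal sum of terms a · xⁱ yʲ zᵏ; several
  -- lists represent the same polynomial, with the same evaluation.
  Polynomial : Set c
  Polynomial = List (Carrier × Monomial)

  evalMonomial : Monomial → Point → Carrier
  evalMonomial (i , j , k) (x , y , z) = x ^ i * y ^ j * z ^ k

  eval : Polynomial → Point → Carrier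
  eval g P = foldr (λ (a , m) s → a * evalMonomial m P + s) 0# g

  span : Pred Monomial 0ℓ → Pred Polynomial c
  span M = All (M ∘ proj₂)

  evaluationCode : Pred Polynomial c → ∀ {n} → Vector Point n → Code n
  evaluationCode V P w = ∃ λ g → g ∈ V × w ≋ (λ i → eval g (P i))

module Surface {c ℓ₁ ℓ₂ : Level} (p : ℕ) (F : FiniteField c ℓ₁ ℓ₂ (p ℕ.^ 2)) where

  open FiniteField F
  open Exp semiring using (_^_)
  open Mult semiring using () renaming (_×_ to _·_)
  open Evaluation F

  OnSurface : Pred Point ℓ₁
  OnSurface (x , y , z) =
    y ^ p - y ≈ x ^ (p ℕ.+ 1) * z ^ 2 + x ^ 2 * z ^ (p ℕ.+ 1)

  InT : Pred Point ℓ₁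
  InT P@(x , y , z) = OnSurface P × ¬ (z ≈ 0#)

  T : Setoid (c ⊔ ℓ₁) ℓ₁
  T = On.setoid {B = Σ Point InT} pointSetoid proj₁

  Ordering : ℕ → Set (c ⊔ ℓ₁)
  Ordering n = Inverse (≡.setoid (Fin n)) T

  points : ∀ {n} → Ordering n → Vector Point n
  points o i = proj₁ (Inverse.to o i)

  VMonomial : ℕ → ℕ → Pred Monomial 0ℓ
  VMonomial ρ₁ ρ₂ (i , j , k) =
    i ≤ p ∸ ρ₁ × j ≤ p ∸ ρ₂ × k ≤ p ℕ.^ 2 ∸ 2 ℕ.* p

  V : ℕ → ℕ → Pred Polynomial c
  V ρ₁ ρ₂ = span (VMonomial ρ₁ ρ₂)

  -- 𝔽ₚ ⊆ F is the prime subfield { k · 1 : 0 ≤ k < p }.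
  Fiber : Point → Pred Point ℓ₁
  Fiber (a , b , c) P = ∃ λ (k : Fin p) → P ≈ₚ (a , b + toℕ k · 1# , c)

  fiber? : ∀ Q → Decidable (Fiber Q)
  fiber? (a , b , c) P = any? λ k → P ≟ₚ (a , b + toℕ k · 1# , c)

  SameZ : Point → Pred Point ℓ₁
  SameZ (_ , _ , c) (_ , _ , z) = z ≈ c

  sameZ? : ∀ Q → Decidable (SameZ Q)
  sameZ? (_ , _ , c) (_ , _ , z) = z ≟ c

  lower? : ∀ {n} (o : Ordering n) i → Decidable (λ j → Fiber (points o i) (points o j))
  lower? o i j = fiber? (points o i) (points o j)

  middle? : ∀ {n} (o : Ordering n) i → Decidable (λ j → SameZ (points o i) (points o j))
  middle? o i j = sameZ? (points o i) (points o j)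

{-# OPTIONS --safe #-}

-- Writing X = xᵖ and Z = zᵖ, the right-hand side t of the surface equation
-- satisfies t + tᵖ = (Xz + xZ)(xz + XZ), and y ↦ yᵖ − y maps onto the elements
-- of trace zero with kernel 𝔽ₚ.  So over z ≠ 0 the x-coordinates of T form the
-- union of the two 𝔽ₚ-lines Xz + xZ = 0 and xz + XZ = 0, which coincide when
-- zᵖ = ± z and otherwise meet only in 0, and over each such x lie p points.
-- This counts T.  The distances follow from bounding the number of roots in
-- one variable at a time, in the order z, x, y.
module Submission where

open import Defs
open import Algebra.Apartness.Bundles using (HeytingField)
open import Algebra.Bundles using (CommutativeMonoid; CommutativeRing)
import Algebra.Properties.AbelianGroup as AbelianGroupProperties
import Algebra.Properties.CommutativeMonoid.Sum as CMSum
import Algebra.Properties.CommutativeSemiring.Binomial as Binomial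
import Algebra.Properties.CommutativeSemiring.Exp as CExp
import Algebra.Properties.Group as GroupProperties
import Algebra.Properties.Ring as RingProperties
import Algebra.Properties.Semiring.Exp as Exp
import Algebra.Properties.Semiring.Mult as Mult
import Algebra.Properties.Semiring.Sum as Sum
import Algebra.Solver.Ring.NaturalCoefficients.Default as Solver
open import Data.Empty using (⊥-elim)
open import Data.Fin
  using (Fin; zero; suc; toℕ; fromℕ; fromℕ<; inject₁; inject≤; punchIn; join; splitAt;
         _↑ˡ_; _↑ʳ_; combine; remQuot; finToFun; funToFin)
open import Data.Fin.Permutation using (Permutation; permutation)
open import Data.Fin.Properties as Finₚ
  using (any?; all?; toℕ<n; toℕ-fromℕ; toℕ-fromℕ<; toℕ-inject₁; toℕ-injective;
         suc-injective; inject≤-injective; injective⇒≤; punchInᵢ≢i; splitAt-↑ˡ; splitAt-↑ʳ;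
         join-splitAt; remQuot-combine; combine-remQuot; combine-surjective;
         finToFun-funToFin)
open import Data.List using (List; []; _∷_; length; filter; allFin; lookup; tabulate)
open import Data.List.Membership.Propositional.Properties
  using (∈-filter⁺; ∈-filter⁻; ∈-allFin; ∈-lookup)
open import Data.List.Relation.Unary.All as All using (All; []; _∷_)
import Data.List.Relation.Unary.All.Properties as Allₚ
open import Data.List.Relation.Unary.AllPairs using (_∷_)
open import Data.List.Relation.Unary.Any using (index)
open import Data.List.Relation.Unary.Any.Properties using (lookup-index)
open import Data.List.Relation.Unary.Unique.Propositional using (Unique)
open import Data.List.Relation.Unary.Unique.Propositional.Properties using (allFin⁺; filter⁺)
open import Data.Nat as ℕ using (ℕ; zero; suc; _≤_; _<_; s≤s; z≤n; _∸_; _!)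
open import Data.Nat.Combinatorics using (nCk≡n!/k![n-k]!; k![n∸k]!∣n!; nCn≡1) renaming (_C_ to _choose_)
open import Data.Nat.Coprimality using (prime⇒coprime; coprime-Bézout)
open import Data.Nat.Divisibility using (_∣_; _∤_; divides; m∣m*n; ∣⇒≤; ∣-refl)
open import Data.Nat.DivMod using (m/n*n≡m)
open import Data.Nat.GCD using (module Bézout)
open import Data.Nat.Induction using (<-rec)
open import Data.Nat.Primality using (Prime; euclidsLemma; prime⇒nonZero; prime⇒nonTrivial)
import Data.Nat.Properties as ℕₚ
open import Data.Nat.Solver using (module +-*-Solver)
open import Data.Product using (∃; _×_; _,_; proj₁; proj₂)
open import Data.Sum using (_⊎_; inj₁; inj₂; [_,_]′)
open import Data.Unit using (⊤; tt)
open import Data.Vec.Functional using (Vector)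
import Data.Vec.Functional.Relation.Binary.Equality.Setoid as VecEquality
open import Function using (_∘_; id; Inverse)
open import Level using (Level; _⊔_; 0ℓ)
open import Relation.Binary using (Setoid; tri<; tri≈; tri>)
open import Relation.Binary.PropositionalEquality as ≡ using (_≡_; _≢_)
import Relation.Binary.Reasoning.Setoid as SetoidReasoning
open import Relation.Nullary using (¬_; Dec; yes; no; contradiction)
open import Relation.Nullary.Decidable using (¬?; decidable-stable; _×-dec_; _⊎-dec_)
open import Relation.Unary using (Pred; Decidable; _∈_; _⊆_; _∩_; ∁)

-- One kind of statement yields all code parameters: `Weight` says that a combination of given
-- monomials with some nonzero coefficient is nonzero at no fewer than d points of a set. If d ≥ 1,
-- the monomials are independent as words, which gives the dimension; for differences of codewords
-- it bounds the distance. Weights multiply along a projection: collecting the coefficients of each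
-- fibre monomial gives functions on the base, and where such a function is nonzero the fibre has
-- its own weight. Each factor is the number of values of a variable minus its degree. For z there
-- are p² - 1 values and degree p² - 2p, leaving 2p - 1; for x the p points of the first line, which
-- is there for every z, and degree p - ρ₁; for y a fibre of p points and degree p - ρ₂. The product
-- (2p - 1)ρ₁ρ₂ is at least the stated bound. The slices of constant z differ in size, but each
-- contains a full line, so the lower bound is uniform. Finally, a minimum distance must be
-- attained; it is found by searching the finite set of coefficient vectors.

least : ∀ {ℓ} {P : Pred ℕ ℓ} → Decidable P → ∀ n → P n → ∃ λ m → P m × (∀ k → P k → m ≤ k)
least {P = P} P? = <-rec _ step
  where
  step : ∀ n → (∀ {m} → m < n → P m → ∃ λ k → P k × (∀ j → P j → k ≤ j)) →
         P n → ∃ λ k → P k × (∀ j → P j → k ≤ j)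
  step n rec pn with ℕₚ.anyUpTo? P? n
  ... | yes (m , m<n , pm) = rec m<n pm
  ... | no none = n , pn , λ j pj → ℕₚ.≮⇒≥ λ j<n → none (j , j<n , pj)

lookup-injective : ∀ {a} {A : Set a} {xs : List A} → Unique xs →
  ∀ i j → lookup xs i ≡ lookup xs j → i ≡ j
lookup-injective (_ ∷ _)    zero    zero    _  = ≡.refl
lookup-injective (x∉ ∷ _)   zero    (suc j) eq = contradiction eq (All.lookup x∉ (∈-lookup j))
lookup-injective (x∉ ∷ _)   (suc i) zero    eq = contradiction (≡.sym eq) (All.lookup x∉ (∈-lookup i))
lookup-injective (_ ∷ uniq) (suc i) (suc j) eq = ≡.cong suc (lookup-injective uniq i j eq)

-- Cardinalities and lower bounds for subsets of a setoid

module Counting {a ℓ} (S : Setoid a ℓ) where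

  open Setoid S using (_≈_; refl; sym; trans) renaming (Carrier to A)

  -- Root counting only bounds a set from below, so an injective family of members is kept apart
  -- from the exhaustive enumeration that `Card` adds.
  record AtLeast {r} (P : Pred A r) (m : ℕ) : Set (a ⊔ ℓ ⊔ r) where
    constructor mkAtLeast
    field
      element   : Fin m → A
      member    : ∀ i → element i ∈ P
      injective : ∀ {i j} → element i ≈ element j → i ≡ j

  record Card {r} (P : Pred A r) (m : ℕ) : Set (a ⊔ ℓ ⊔ r) where
    constructor mkCard
    field
      atLeast  : AtLeast P m
    open AtLeast atLeast public
    field
      complete : ∀ {x} → x ∈ P → ∃ λ i → x ≈ element i

  AtLeast-mono : ∀ {r s} {P : Pred A r} {Q : Pred A s} → P ⊆ Q → ∀ {m} → AtLeast P m → AtLeast Q m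
  AtLeast-mono P⊆Q (mkAtLeast f f∈ inj) = mkAtLeast f (P⊆Q ∘ f∈) inj

  AtLeast-≤ : ∀ {r} {P : Pred A r} {m n} → m ≤ n → AtLeast P n → AtLeast P m
  AtLeast-≤ m≤n (mkAtLeast f f∈ inj) =
    mkAtLeast (λ i → f (inject≤ i m≤n)) (λ _ → f∈ _) (λ eq → inject≤-injective m≤n m≤n _ _ (inj eq))

  Card-cong : ∀ {r s} {P : Pred A r} {Q : Pred A s} → P ⊆ Q → Q ⊆ P → ∀ {m} → Card P m → Card Q m
  Card-cong P⊆Q Q⊆P (mkCard al c) = mkCard (AtLeast-mono P⊆Q al) (c ∘ Q⊆P)

  -- Pigeonhole: sending each listed element to its place in the enumeration of `Q` is injective.
  AtLeast≤Card : ∀ {r s} {P : Pred A r} {Q : Pred A s} → P ⊆ Q → ∀ {m n} → AtLeast P m → Card Q n → m ≤ n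
  AtLeast≤Card P⊆Q (mkAtLeast f f∈ inj) (mkCard (mkAtLeast g _ _) c) =
    injective⇒≤ {f = λ i → proj₁ (c (P⊆Q (f∈ i)))} λ {i} {j} eq →
      inj (trans (proj₂ (c (P⊆Q (f∈ i)))) (trans (Setoid.reflexive S (≡.cong g eq)) (sym (proj₂ (c (P⊆Q (f∈ j)))))))

  Card-unique : ∀ {r s} {P : Pred A r} {Q : Pred A s} → P ⊆ Q → Q ⊆ P → ∀ {m n} → Card P m → Card Q n → m ≡ n
  Card-unique P⊆Q Q⊆P c d = ℕₚ.≤-antisym (AtLeast≤Card P⊆Q (Card.atLeast c) d) (AtLeast≤Card Q⊆P (Card.atLeast d) c)

  Card-empty : ∀ {r} {P : Pred A r} → (∀ {x} → ¬ P x) → Card P 0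
  Card-empty ¬P = mkCard (mkAtLeast (λ ()) (λ ()) λ {}) (λ p → ⊥-elim (¬P p))

  Card-singleton : ∀ {r} {P : Pred A r} {x} → P x → (∀ {y} → P y → y ≈ x) → Card P 1
  Card-singleton px u = mkCard (mkAtLeast (λ _ → _) (λ _ → px) λ { {zero} {zero} _ → ≡.refl }) (λ py → zero , u py)

  AtLeast-⊎ : ∀ {r s t} {P : Pred A r} {Q : Pred A s} {R : Pred A t} →
    P ⊆ R → Q ⊆ R → (∀ {x y} → P x → Q y → ¬ x ≈ y) →
    ∀ {m n} → AtLeast P m → AtLeast Q n → AtLeast R (m ℕ.+ n)
  AtLeast-⊎ {R = R} P⊆R Q⊆R disj {m} {n} (mkAtLeast f f∈ f-inj) (mkAtLeast g g∈ g-inj) =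
    mkAtLeast (h ∘ splitAt m) (λ i → h∈ (splitAt m i)) (λ {i} {j} eq → split-inj i j (h-inj _ _ eq))
    where
    h : Fin m ⊎ Fin n → A
    h = [ f , g ]′
    h∈ : ∀ s → R (h s)
    h∈ (inj₁ i) = P⊆R (f∈ i)
    h∈ (inj₂ i) = Q⊆R (g∈ i)
    h-inj : ∀ s t → h s ≈ h t → s ≡ t
    h-inj (inj₁ i) (inj₁ j) eq = ≡.cong inj₁ (f-inj eq)
    h-inj (inj₁ i) (inj₂ j) eq = ⊥-elim (disj (f∈ i) (g∈ j) eq)
    h-inj (inj₂ i) (inj₁ j) eq = ⊥-elim (disj (f∈ j) (g∈ i) (sym eq))
    h-inj (inj₂ i) (inj₂ j) eq = ≡.cong inj₂ (g-inj eq)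
    split-inj : ∀ i j → splitAt m i ≡ splitAt m j → i ≡ j
    split-inj i j eq = ≡.trans (≡.sym (join-splitAt m n i))
      (≡.trans (≡.cong (join m n) eq) (join-splitAt m n j))

  Card-⊎ : ∀ {r s t} {P : Pred A r} {Q : Pred A s} {R : Pred A t} →
    P ⊆ R → Q ⊆ R → (∀ {x} → R x → P x ⊎ Q x) → (∀ {x y} → P x → Q y → ¬ x ≈ y) →
    ∀ {m n} → Card P m → Card Q n → Card R (m ℕ.+ n)
  Card-⊎ {P = P} {Q} P⊆R Q⊆R split disj {m} {n} cP cQ =
    mkCard al (λ rx → cover (split rx))
    where
    al = AtLeast-⊎ P⊆R Q⊆R disj (Card.atLeast cP) (Card.atLeast cQ)
    cover : ∀ {x} → P x ⊎ Q x → ∃ λ i → x ≈ AtLeast.element al i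
    cover (inj₁ px) with i , eq ← Card.complete cP px =
      i ↑ˡ n , trans eq (Setoid.reflexive S (≡.cong [ Card.element cP , Card.element cQ ]′ (≡.sym (splitAt-↑ˡ m i n))))
    cover (inj₂ qx) with i , eq ← Card.complete cQ qx =
      m ↑ʳ i , trans eq (Setoid.reflexive S (≡.cong [ Card.element cP , Card.element cQ ]′ (≡.sym (splitAt-↑ʳ m n i))))

  private
    shift : ∀ {r} {P : Pred A r} {n} (c : Card P (suc n)) → Card (λ x → P x × ¬ x ≈ Card.element c zero) n
    shift (mkCard (mkAtLeast f f∈ inj) c) = mkCard
      (mkAtLeast (f ∘ suc) (λ i → f∈ (suc i) , λ eq → contradiction (inj eq) λ ())
        (suc-injective ∘ inj))
      λ { (px , x≉) → aux x≉ (c px) }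
      where
      aux : ∀ {x} → ¬ x ≈ f zero → (∃ λ i → x ≈ f i) → ∃ λ i → x ≈ f (suc i)
      aux x≉ (zero , eq) = ⊥-elim (x≉ eq)
      aux x≉ (suc i , eq) = i , eq

  -- Induction on the enumeration: its first element joins the side that `Q?` assigns to it, and
  -- `resp` carries this verdict to every equivalent representative.
  Card-partition : ∀ {r s} {P : Pred A r} {Q : Pred A s} → Decidable Q → (∀ {x y} → x ≈ y → Q x → Q y) →
    ∀ {n} → Card P n → ∃ λ k → ∃ λ l → Card (P ∩ Q) k × Card (P ∩ ∁ Q) l × k ℕ.+ l ≡ n
  Card-partition {P = P} {Q} Q? resp {zero} (mkCard _ c) =
    0 , 0 , Card-empty (none Q) , Card-empty (none (∁ Q)) , ≡.refl
    where
    none : ∀ {r} (R : Pred A r) {x} → ¬ (P x × R x)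
    none R (px , _) with () ← c px
  Card-partition {P = P} {Q} Q? resp {suc n} c
    with k , l , cQ , cR , eq ← Card-partition Q? resp (shift c)
    with Q? (Card.element c zero)
  ... | yes q = suc k , l ,
        Card-⊎ {P = λ x → P x × Q x × x ≈ x₀} (λ (px , qx , _) → px , qx)
          (λ ((px , _) , qx) → px , qx) split (λ (_ , _ , x≈) ((_ , y≉) , _) eq → y≉ (trans (sym eq) x≈))
          (Card-singleton (Card.member c zero , q , refl) (λ (_ , _ , e) → e)) cQ ,
        Card-cong (λ ((px , _) , qx) → px , qx)
          (λ (px , ¬qx) → (px , λ e → ¬qx (resp (sym e) q)) , ¬qx) cR ,
        ≡.cong suc eq
    where
    x₀ = Card.element c zero
    split : ∀ {x} → P x × Q x → (P x × Q x × x ≈ x₀) ⊎ ((P x × ¬ x ≈ x₀) × Q x)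
    split (px , qx) with Card.complete c px
    ... | zero , e = inj₁ (px , qx , e)
    ... | suc i , e = inj₂ ((px , λ e′ → contradiction (Card.injective c (trans (sym e′) e)) λ ()) , qx)
  ... | no ¬q = k , suc l ,
        Card-cong (λ ((px , _) , qx) → px , qx)
          (λ (px , qx) → (px , λ e → ¬q (resp e qx)) , qx) cQ ,
        Card-⊎ {P = λ x → P x × (¬ Q x) × x ≈ x₀} (λ (px , qx , _) → px , qx)
          (λ ((px , _) , qx) → px , qx) split (λ (_ , _ , x≈) ((_ , y≉) , _) eq → y≉ (trans (sym eq) x≈))
          (Card-singleton (Card.member c zero , ¬q , refl) (λ (_ , _ , e) → e)) cR ,
        ≡.trans (ℕₚ.+-suc k l) (≡.cong suc eq)
    where
    x₀ = Card.element c zero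
    split : ∀ {x} → P x × ¬ Q x → (P x × (¬ Q x) × x ≈ x₀) ⊎ ((P x × ¬ x ≈ x₀) × ¬ Q x)
    split (px , qx) with Card.complete c px
    ... | zero , e = inj₁ (px , qx , e)
    ... | suc i , e = inj₂ ((px , λ e′ → contradiction (Card.injective c (trans (sym e′) e)) λ ()) , qx)

  Card-complement : ∀ {r s} {P : Pred A r} {Q : Pred A s} → Decidable Q → (∀ {x y} → x ≈ y → Q x → Q y) →
    ∀ {n k} → Card P n → Card (P ∩ Q) k → Card (P ∩ ∁ Q) (n ∸ k)
  Card-complement Q? resp {n} {k} cP cPQ with k′ , l , cPQ′ , cR , eq ← Card-partition Q? resp cP
    with ≡.refl ← Card-unique id id cPQ′ cPQ =
    ≡.subst (Card _) (≡.trans (≡.sym (ℕₚ.m+n∸m≡n k l)) (≡.cong (_∸ k) eq)) cR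

  AtLeast⇒Card : ∀ {r} {P : Pred A r} {m} (al : AtLeast P m) → Card (λ x → ∃ λ i → x ≈ AtLeast.element al i) m
  AtLeast⇒Card (mkAtLeast f _ inj) = mkCard (mkAtLeast f (λ i → i , refl) inj) id

-- Counting along maps and fibrations

module Bundle {a ℓ b ℓ′} (S : Setoid a ℓ) (B : Setoid b ℓ′) where

  open Setoid S using () renaming (Carrier to A; _≈_ to _≈₁_)
  open Setoid B using () renaming (Carrier to Base; _≈_ to _≈₂_)
  module CS = Counting S
  module CB = Counting B

  Card-map : (f : A → Base) → ∀ {r s} {P : Pred A r} {Q : Pred Base s} →
    (∀ {x} → P x → Q (f x)) → (∀ {x y} → f x ≈₂ f y → x ≈₁ y) →
    (∀ {y} → Q y → ∃ λ x → P x × y ≈₂ f x) → (∀ {x y} → x ≈₁ y → f x ≈₂ f y) →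
    ∀ {n} → CS.Card P n → CB.Card Q n
  Card-map f f∈ f-inj preimage f-cong c = CB.mkCard
    (CB.mkAtLeast (f ∘ CS.Card.element c) (λ i → f∈ (CS.Card.member c i)) (CS.Card.injective c ∘ f-inj))
    λ y∈ → let x , x∈ , y≈ = preimage y∈; i , x≈ = CS.Card.complete c x∈ in
      i , Setoid.trans B y≈ (f-cong x≈)

  module _ (π : A → Base) (π-cong : ∀ {x y} → x ≈₁ y → π x ≈₂ π y)
    {r s} {P : Pred A r} {R : Pred Base s} where

    -- Elements chosen over different base points cannot coincide, because `π` recovers the base
    -- point; within one fibre they differ by assumption.
    AtLeast-bundle : ∀ {m n} → CB.AtLeast R m →
      (∀ y → R y → CS.AtLeast (λ x → P x × π x ≈₂ y) n) → CS.AtLeast P (m ℕ.* n)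
    AtLeast-bundle {m} {n} (CB.mkAtLeast f f∈ f-inj) fibre = CS.mkAtLeast
      (h ∘ remQuot n)
      (λ i → proj₁ (F.member (proj₁ (remQuot {m} n i)) (proj₂ (remQuot {m} n i))))
      λ {i} {j} eq → ≡.trans (≡.sym (combine-remQuot {m} n i))
        (≡.trans (≡.cong (λ (k , l) → combine k l) (h-inj _ _ eq)) (combine-remQuot {m} n j))
      where
      module F i = CS.AtLeast (fibre (f i) (f∈ i))
      h : Fin m × Fin n → A
      h (i , j) = F.element i j
      over : ∀ i j → π (h (i , j)) ≈₂ f i
      over i j = proj₂ (F.member i j)
      h-inj : ∀ u v → h u ≈₁ h v → u ≡ v
      h-inj (i , j) (k , l) eq
        with ≡.refl ← f-inj {i} {k} (Setoid.trans B (Setoid.sym B (over i j)) (Setoid.trans B (π-cong eq) (over k l)))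
        = ≡.cong (i ,_) (F.injective i eq)

    Card-bundle : (∀ {x} → P x → R (π x)) → ∀ {m n} → CB.Card R m →
      (∀ y → R y → CS.Card (λ x → P x × π x ≈₂ y) n) → CS.Card P (m ℕ.* n)
    Card-bundle P⇒R {m} {n} cR fibre = CS.mkCard al cover
      where
      al = AtLeast-bundle (CB.Card.atLeast cR) (λ y ry → CS.Card.atLeast (fibre y ry))
      cover : ∀ {x} → P x → ∃ λ i → x ≈₁ CS.AtLeast.element al i
      cover px with i , e ← CB.Card.complete cR (P⇒R px)
        with j , e′ ← CS.Card.complete (fibre (CB.Card.element cR i) (CB.Card.member cR i)) (px , e) =
        combine i j , Setoid.trans S e′ (Setoid.reflexive S
          (≡.cong (λ (k , l) → CS.Card.element (fibre _ (CB.Card.member cR k)) l) (≡.sym (remQuot-combine i j))))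

module CountFin {n : ℕ} where
  open Counting (≡.setoid (Fin n)) public

  -- Hamming distances and lengths of punctured codes are both defined as lengths of a filtered
  -- `allFin`; through this lemma the counting results apply to them.
  filter-Card : ∀ {r} {P : Pred (Fin n) r} (P? : Decidable P) → Card P (length (filter P? (allFin n)))
  filter-Card P? = mkCard
    (mkAtLeast (lookup xs) (λ i → proj₂ (∈-filter⁻ P? {xs = allFin n} (∈-lookup i)))
      (lookup-injective (filter⁺ P? (allFin⁺ n)) _ _))
    (λ {x} px → let x∈ = ∈-filter⁺ P? (∈-allFin x) px in index x∈ , lookup-index x∈)
    where
    xs = filter P? (allFin n)

-- Inverses and zero divisors in a finite field

module Field {c ℓ₁ ℓ₂ : Level} {q : ℕ} (F : FiniteField c ℓ₁ ℓ₂ q) where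

  open FiniteField F public using (heytingField; enumeration; commutativeRing; _≟_)
  open CommutativeRing commutativeRing public hiding (zero)
  open Exp semiring public
  open RingProperties ring public using (-‿distribˡ-*; -‿distribʳ-*; x[y-z]≈xy-xz; -1*x≈-x)
  open GroupProperties +-group public using () renaming
    (ε⁻¹≈ε to -0≈0; x∙y⁻¹≈ε⇒x≈y to x-y≈0⇒x≈y; x≈y⇒x∙y⁻¹≈ε to x≈y⇒x-y≈0; ⁻¹-involutive to -‿involutive;
     inverseˡ-unique to x+y≈0⇒x≈-y; inverseʳ-unique to x+y≈0⇒y≈-x)
  module CSolver = Solver commutativeSemiring
  open SetoidReasoning setoid

  elt : Fin q → Carrier
  elt = Inverse.from enumeration

  idx : Carrier → Fin q
  idx = Inverse.to enumeration

  elt-idx : ∀ x → elt (idx x) ≈ x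
  elt-idx = Inverse.strictlyInverseʳ enumeration

  idx-elt : ∀ i → idx (elt i) ≡ i
  idx-elt = Inverse.strictlyInverseˡ enumeration

  -- The apartness is not assumed decidable, so only the double negation of
  -- invertibility is immediate; a search through the field removes it.
  inverse : ∀ x → ¬ x ≈ 0# → ∃ λ y → x * y ≈ 1#
  inverse x x≉0 with any? (λ i → x * elt i ≟ 1#)
  ... | yes (i , eq) = elt i , eq
  ... | no none = ⊥-elim (x≉0 (proj₁ (tight x 0#) λ x#0 →
      let y , _ , xy≈1 = #⇒invertible x#0 in
      none (idx y , (begin
        x * elt (idx y)   ≈⟨ *-congˡ (elt-idx y) ⟩
        x * y             ≈⟨ *-congʳ x≈x-0 ⟩
        (x - 0#) * y      ≈⟨ xy≈1 ⟩
        1#                ∎))))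
    where
    open HeytingField heytingField using (tight; #⇒invertible)
    x≈x-0 : x ≈ x - 0#
    x≈x-0 = sym (trans (+-congˡ -0≈0) (+-identityʳ x))

  x*y≈0⇒y≈0 : ∀ {x y} → ¬ x ≈ 0# → x * y ≈ 0# → y ≈ 0#
  x*y≈0⇒y≈0 {x} {y} x≉0 xy≈0 = let z , xz≈1 = inverse x x≉0 in begin
    y            ≈⟨ *-identityˡ y ⟨
    1# * y       ≈⟨ *-congʳ xz≈1 ⟨
    (x * z) * y  ≈⟨ *-congʳ (*-comm x z) ⟩
    (z * x) * y  ≈⟨ *-assoc z x y ⟩
    z * (x * y)  ≈⟨ *-congˡ xy≈0 ⟩
    z * 0#       ≈⟨ zeroʳ z ⟩
    0#           ∎

  *-cancelˡ : ∀ {x y z} → ¬ x ≈ 0# → x * y ≈ x * z → y ≈ z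
  *-cancelˡ {x} {y} {z} x≉0 eq = x-y≈0⇒x≈y y z
    (x*y≈0⇒y≈0 x≉0 (trans (x[y-z]≈xy-xz x y z) (x≈y⇒x-y≈0 eq)))

  x*y≈0⇒x≈0⊎y≈0 : ∀ {x y} → x * y ≈ 0# → x ≈ 0# ⊎ y ≈ 0#
  x*y≈0⇒x≈0⊎y≈0 {x} xy≈0 with x ≟ 0#
  ... | yes x≈0 = inj₁ x≈0
  ... | no x≉0 = inj₂ (x*y≈0⇒y≈0 x≉0 xy≈0)

  *-nonzero : ∀ {x y} → ¬ x ≈ 0# → ¬ y ≈ 0# → ¬ x * y ≈ 0#
  *-nonzero x≉0 y≉0 = y≉0 ∘ x*y≈0⇒y≈0 x≉0

-- Linear combinations and finite sums

module LinearCombinations {c ℓ₁ ℓ₂ : Level} {q : ℕ} (F : FiniteField c ℓ₁ ℓ₂ q) where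

  open Field F
  open Sum semiring
  open SetoidReasoning setoid

  comb : ∀ {a} {A : Set a} {s} → Vector Carrier s → (Fin s → A → Carrier) → A → Carrier
  comb a φ P = sum (λ i → a i * φ i P)

  comb-point-cong : ∀ {a} {A : Set a} {s} (a : Vector Carrier s) (φ : Fin s → A → Carrier) {P Q} →
    (∀ i → φ i P ≈ φ i Q) → comb a φ P ≈ comb a φ Q
  comb-point-cong a φ eq = sum-cong-≋ λ i → *-congˡ (eq i)

  unit : ∀ {n} → Fin n → Vector Carrier n
  unit zero    zero    = 1#
  unit zero    (suc _) = 0#
  unit (suc _) zero    = 0#
  unit (suc i) (suc j) = unit i j

  unit-diagonal : ∀ {n} (i : Fin n) → unit i i ≈ 1#
  unit-diagonal zero    = refl
  unit-diagonal (suc i) = unit-diagonal i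

  unit-off-diagonal : ∀ {n} (i j : Fin n) → i ≢ j → unit i j ≈ 0#
  unit-off-diagonal zero    zero    i≢j = contradiction ≡.refl i≢j
  unit-off-diagonal zero    (suc j) i≢j = refl
  unit-off-diagonal (suc i) zero    i≢j = refl
  unit-off-diagonal (suc i) (suc j) i≢j = unit-off-diagonal i j (i≢j ∘ ≡.cong suc)

  sum-cong : ∀ {n} {f g : Vector Carrier n} → (∀ i → f i ≈ g i) → sum f ≈ sum g
  sum-cong {f = f} {g} = sum-cong-≋ {x = f} {g}

  sum-zero : ∀ {n} (f : Vector Carrier n) → (∀ i → f i ≈ 0#) → sum f ≈ 0#
  sum-zero {n} f f≈0 = trans (sum-cong-≋ f≈0) (sum-replicate-zero n)

  sum-unit : ∀ {n} (i : Fin n) (f : Vector Carrier n) → sum (λ j → unit i j * f j) ≈ f i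
  sum-unit zero f = begin
    1# * f zero + sum (λ j → 0# * f (suc j)) ≈⟨ +-cong (*-identityˡ _) (sum-zero _ λ j → zeroˡ (f (suc j))) ⟩
    f zero + 0#                              ≈⟨ +-identityʳ _ ⟩
    f zero                                   ∎
  sum-unit (suc i) f = begin
    0# * f zero + sum (λ j → unit i j * f (suc j)) ≈⟨ +-cong (zeroˡ _) (sum-unit i (f ∘ suc)) ⟩
    0# + f (suc i)                                 ≈⟨ +-identityˡ _ ⟩
    f (suc i)                                      ∎

  sum-+ : ∀ m {n} (f : Vector Carrier (m ℕ.+ n)) → sum f ≈ sum (λ i → f (i ↑ˡ n)) + sum (λ j → f (m ↑ʳ j))
  sum-+ zero    f = sym (+-identityˡ _)
  sum-+ (suc m) f = trans (+-congˡ (sum-+ m (f ∘ suc))) (sym (+-assoc _ _ _))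

  sum-combine : ∀ m {n} (f : Vector Carrier (m ℕ.* n)) → sum f ≈ sum (λ i → sum (λ j → f (combine {m} {n} i j)))
  sum-combine zero        f = refl
  sum-combine (suc m) {n} f = trans (sum-+ n f) (+-congˡ (sum-combine m (λ i → f (n ↑ʳ i))))

  -- The form u + κv serves two purposes: adding one more term to a combination, and, with κ = - 1,
  -- subtracting combinations.
  comb-linear : ∀ {a} {A : Set a} {s} (u v : Vector Carrier s) (κ : Carrier) (φ : Fin s → A → Carrier) P →
    comb (λ i → u i + κ * v i) φ P ≈ comb u φ P + κ * comb v φ P
  comb-linear u v κ φ P = begin
    sum (λ i → (u i + κ * v i) * φ i P)
      ≈⟨ sum-cong {f = λ i → (u i + κ * v i) * φ i P}
           (λ i → trans (distribʳ (φ i P) (u i) (κ * v i)) (+-congˡ (*-assoc κ (v i) (φ i P)))) ⟩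
    sum (λ i → u i * φ i P + κ * (v i * φ i P))
      ≈⟨ ∑-distrib-+ (λ i → u i * φ i P) _ ⟩
    comb u φ P + sum (λ i → κ * (v i * φ i P))
      ≈⟨ +-congˡ (sym (*-distribˡ-sum κ (λ i → v i * φ i P))) ⟩
    comb u φ P + κ * comb v φ P ∎

  comb-sub : ∀ {a} {A : Set a} {s} (u v : Vector Carrier s) (φ : Fin s → A → Carrier) P →
    comb (λ i → u i + - 1# * v i) φ P ≈ comb u φ P - comb v φ P
  comb-sub u v φ P = trans (comb-linear u v (- 1#) φ P) (+-congˡ (-1*x≈-x _))

-- Roots of polynomials in one variable

module Polynomials {c ℓ₁ ℓ₂ : Level} {q : ℕ} (F : FiniteField c ℓ₁ ℓ₂ q) where

  open Field F
  open LinearCombinations F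
  open Sum semiring
  open SetoidReasoning setoid

  -- In Horner's form division by x - r becomes a structural recursion on the coefficients;
  -- `horner-sum` leads back to sums of powers.
  horner : ∀ {n} → Vector Carrier n → Carrier → Carrier
  horner {zero}  a x = 0#
  horner {suc n} a x = a zero + x * horner (a ∘ suc) x

  horner-sum : ∀ {n} (a : Vector Carrier n) x → horner a x ≈ sum (λ j → a j * x ^ toℕ j)
  horner-sum {zero}  a x = refl
  horner-sum {suc n} a x = +-cong (sym (*-identityʳ _)) (begin
    x * horner (a ∘ suc) x                       ≈⟨ *-congˡ (horner-sum (a ∘ suc) x) ⟩
    x * sum (λ j → a (suc j) * x ^ toℕ j)        ≈⟨ *-distribˡ-sum x (λ j → a (suc j) * x ^ toℕ j) ⟩
    sum (λ j → x * (a (suc j) * x ^ toℕ j))      ≈⟨ sum-cong-≋ (λ j → swap x (a (suc j)) (x ^ toℕ j)) ⟩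
    sum (λ j → a (suc j) * (x * x ^ toℕ j))      ∎)
    where
    open CSolver
    swap : ∀ x y z → x * (y * z) ≈ y * (x * z)
    swap = solve 3 (λ x y z → x :* (y :* z) := y :* (x :* z)) refl

  -- Synthetic division by x - r: the i-th coefficient is the value at r of what remains of `a`
  -- after its first i + 1 coefficients are dropped.
  quotient : ∀ {n} → Vector Carrier (suc n) → Carrier → Vector Carrier n
  quotient {suc n} a r zero    = horner (a ∘ suc) r
  quotient {suc n} a r (suc i) = quotient (a ∘ suc) r i

  -- a(x) − a(r) = (x − r)·quotient(x), moved so that no subtraction occurs.
  horner-quotient : ∀ {n} (a : Vector Carrier (suc n)) r x →
    horner a x + r * horner (quotient a r) x ≈ horner a r + x * horner (quotient a r) x
  horner-quotient {zero} a r x = solve 3 (λ a r x → a :+ x :* con 0 :+ r :* con 0 := a :+ r :* con 0 :+ x :* con 0) refl (a zero) r x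
    where open CSolver
  horner-quotient {suc n} a r x = begin
    A + x * Ex + r * (Er + x * Q)   ≈⟨ step₁ A r x Ex Er Q ⟩
    A + r * Er + x * (Ex + r * Q)   ≈⟨ +-congˡ (*-congˡ (horner-quotient (a ∘ suc) r x)) ⟩
    A + r * Er + x * (Er + x * Q)   ∎
    where
    open CSolver
    A  = a zero
    Ex = horner (a ∘ suc) x
    Er = horner (a ∘ suc) r
    Q  = horner (quotient (a ∘ suc) r) x
    step₁ : ∀ A r x Ex Er Q → A + x * Ex + r * (Er + x * Q) ≈ A + r * Er + x * (Ex + r * Q)
    step₁ = solve 6 (λ A r x Ex Er Q →
      A :+ x :* Ex :+ r :* (Er :+ x :* Q) := A :+ r :* Er :+ x :* (Ex :+ r :* Q)) refl

  -- The constant coefficient of the quotient is the value at r of the tail of `a`. Its vanishing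
  -- kills the part of a(r) beyond `a zero`, and is also the root hypothesis for the tail.
  quotient-zero : ∀ {n} (a : Vector Carrier (suc n)) r →
    (∀ i → quotient a r i ≈ 0#) → horner a r ≈ 0# → ∀ j → a j ≈ 0#
  quotient-zero {zero} a r _ root zero =
    trans (sym (trans (+-congˡ (zeroʳ r)) (+-identityʳ _))) root
  quotient-zero {suc n} a r q≈0 root zero = begin
    a zero                             ≈⟨ trans (+-congˡ (trans (*-congˡ (q≈0 zero)) (zeroʳ r))) (+-identityʳ _) ⟨
    a zero + r * horner (a ∘ suc) r    ≈⟨ root ⟩
    0#                                 ∎
  quotient-zero {suc n} a r q≈0 root (suc j) = quotient-zero (a ∘ suc) r (q≈0 ∘ suc) (q≈0 zero) j

  -- A polynomial of degree below n with n distinct roots is zero. After division by x - r, any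
  -- other root x remains a root of the quotient Q: otherwise r · Q(x) = x · Q(x) could be cancelled
  -- to r = x.
  all-roots⇒zero : ∀ {n} (a : Vector Carrier n) (f : Fin n → Carrier) →
    (∀ {i j} → f i ≈ f j → i ≡ j) → (∀ i → horner a (f i) ≈ 0#) → ∀ j → a j ≈ 0#
  all-roots⇒zero {suc n} a f f-inj roots = quotient-zero a r
    (all-roots⇒zero (quotient a r) (f ∘ suc) (Finₚ.suc-injective ∘ f-inj) quotient-roots) (roots zero)
    where
    r = f zero
    quotient-roots : ∀ i → horner (quotient a r) (f (suc i)) ≈ 0#
    quotient-roots i with horner (quotient a r) (f (suc i)) ≟ 0#
    ... | yes Q≈0 = Q≈0
    ... | no  Q≉0 = contradiction (f-inj {zero} {suc i} (*-cancelˡ Q≉0 (begin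
        Q * r                  ≈⟨ *-comm Q r ⟩
        r * Q                  ≈⟨ +-identityˡ _ ⟨
        0# + r * Q             ≈⟨ +-congʳ (roots (suc i)) ⟨
        horner a x + r * Q     ≈⟨ horner-quotient a r x ⟩
        horner a r + x * Q     ≈⟨ +-congʳ (roots zero) ⟩
        0# + x * Q             ≈⟨ +-identityˡ _ ⟩
        x * Q                  ≈⟨ *-comm x Q ⟩
        Q * x                  ∎))) λ ()
      where
      x = f (suc i)
      Q = horner (quotient a r) x

-- Lower bounds for the number of nonzero values

module Weights {c ℓ₁ ℓ₂ : Level} {q : ℕ} (F : FiniteField c ℓ₁ ℓ₂ q) where

  open Field F
  open LinearCombinations F
  open Polynomials F
  open Sum semiring

  -- The assumption is a nonzero coefficient rather than a nonzero function, so that d ≥ 1 already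
  -- includes linear independence of the `φ` on `P`.
  Weight : ∀ {a ℓ r} (S : Setoid a ℓ) → Pred (Setoid.Carrier S) r →
    ∀ {s} → (Fin s → Setoid.Carrier S → Carrier) → ℕ → Set _
  Weight S P {s} φ d = (a : Vector Carrier s) (j : Fin s) → ¬ a j ≈ 0# →
    Counting.AtLeast S (λ x → P x × ¬ comb a φ x ≈ 0#) d

  module _ {a ℓ} (S : Setoid a ℓ) where
    open Setoid S using () renaming (Carrier to A; _≈_ to _≈₁_)
    open Counting S

    -- Among the m listed points fewer than s are roots, since s roots would annihilate all s
    -- coefficients. Hence at least m - s + 1 are left; `d ℕ.+ s ≤ suc m` says so without
    -- subtraction. The coordinate `v` has to separate only the listed points, since elsewhere in
    -- `S` other coordinates may vary.
    power-weight : ∀ {r} {P : Pred A r} (v : A → Carrier) → (∀ {x y} → x ≈₁ y → v x ≈ v y) →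
      ∀ {m} (al : AtLeast P m) → (∀ {i j} → v (AtLeast.element al i) ≈ v (AtLeast.element al j) → i ≡ j) →
      ∀ {s d} → d ℕ.+ s ≤ suc m → Weight S P {s} (λ j x → v x ^ toℕ j) d
    power-weight {P = P} v v-cong {m} al v-inj {s} {d} d+s≤1+m a j a≉0 =
      conclude (Card-partition root? root-cong (AtLeast⇒Card al))
      where
      poly : A → Carrier
      poly = comb a (λ j x → v x ^ toℕ j)
      root? : Decidable (λ x → poly x ≈ 0#)
      root? x = poly x ≟ 0#
      poly-cong : ∀ {x y} → x ≈₁ y → poly x ≈ poly y
      poly-cong x≈y = comb-point-cong a (λ j x → v x ^ toℕ j) λ i → ^-congˡ (toℕ i) (v-cong x≈y)
      root-cong : ∀ {x y} → x ≈₁ y → poly x ≈ 0# → poly y ≈ 0#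
      root-cong x≈y = trans (sym (poly-cong x≈y))
      Listed : A → Set _
      Listed x = ∃ λ i → x ≈₁ AtLeast.element al i
      few-roots : ∀ {k} → Card (Listed ∩ (λ x → poly x ≈ 0#)) k → ¬ s ≤ k
      few-roots c s≤k = a≉0 (all-roots⇒zero a (v ∘ element)
        (λ {i} {k} eq → injective (index-inj (member i) (member k) eq))
        (λ i → trans (horner-sum a _) (proj₂ (member i))) j)
        where
        open AtLeast (AtLeast-≤ s≤k (Card.atLeast c))
        index-inj : ∀ {x y} → Listed x × poly x ≈ 0# → Listed y × poly y ≈ 0# → v x ≈ v y → x ≈₁ y
        index-inj ((i , x≈) , _) ((k , y≈) , _) eq
          with ≡.refl ← v-inj {i} {k} (trans (sym (v-cong x≈)) (trans eq (v-cong y≈)))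
          = Setoid.trans S x≈ (Setoid.sym S y≈)
      conclude : (∃ λ k → ∃ λ l → Card (Listed ∩ (λ x → poly x ≈ 0#)) k ×
                   Card (Listed ∩ ∁ (λ x → poly x ≈ 0#)) l × k ℕ.+ l ≡ m) →
                 AtLeast (λ x → P x × ¬ poly x ≈ 0#) d
      conclude (k , l , cR , cN , k+l≡m) = mkAtLeast
        (λ i → AtLeast.element al (pos i))
        (λ i → AtLeast.member al (pos i) , λ eq → proj₂ (member i) (root-cong (Setoid.sym S (at i)) eq))
        (λ {i} {j} eq → injective (Setoid.trans S (at i) (Setoid.trans S eq (Setoid.sym S (at j)))))
        where
        k<s : k < s
        k<s = ℕₚ.≰⇒> (few-roots cR)
        d≤l : d ≤ l
        d≤l = ℕₚ.+-cancelʳ-≤ s d l (let open ℕₚ.≤-Reasoning in begin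
          d ℕ.+ s          ≤⟨ d+s≤1+m ⟩
          suc m            ≡⟨ ≡.cong suc k+l≡m ⟨
          suc (k ℕ.+ l)    ≤⟨ ℕₚ.+-monoˡ-≤ l k<s ⟩
          s ℕ.+ l          ≡⟨ ℕₚ.+-comm s l ⟩
          l ℕ.+ s          ∎)
        open AtLeast (AtLeast-≤ d≤l (Card.atLeast cN))
        pos : Fin d → Fin m
        pos i = proj₁ (proj₁ (member i))
        at : ∀ i → element i ≈₁ AtLeast.element al (pos i)
        at i = proj₂ (proj₁ (member i))

  module _ {a ℓ b ℓ′} (S : Setoid a ℓ) (B : Setoid b ℓ′) where
    open Setoid S using () renaming (Carrier to A; _≈_ to _≈₁_)
    open Setoid B using () renaming (Carrier to Base; _≈_ to _≈₂_)

    -- Grouping by the fibre index makes the coefficients functions on the base.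
    bundle-weight : (π : A → Base) → (∀ {x y} → x ≈₁ y → π x ≈₂ π y) →
      ∀ {r r′} {P : Pred A r} {R : Pred Base r′}
      {s t d e} (φ : Fin s → A → Carrier) (ψ : Fin t → Base → Carrier) (Φ : Fin (s ℕ.* t) → A → Carrier) →
      (∀ i j {x y} → π x ≈₂ y → Φ (combine i j) x ≈ φ i x * ψ j y) →
      Weight B R ψ d → (∀ y → R y → Weight S (λ x → P x × π x ≈₂ y) φ e) →
      Weight S P Φ (d ℕ.* e)
    bundle-weight π π-cong {P = P} {R} {s} {t} {d} {e} φ ψ Φ Φ≈ base fibre a k ak≉0
      with i , j , ≡.refl ← combine-surjective {s} {t} k =
      Bundle.AtLeast-bundle S B π π-cong
        (base (λ j → a (combine {s} {t} i j)) j ak≉0)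
        λ y (Ry , coeff≉0) → CS.AtLeast-mono
          (λ {x} ((Px , πx≈y) , comb≉0) → (Px , λ eq → comb≉0 (trans (sym (regroup x y πx≈y)) eq)) , πx≈y)
          (fibre y Ry (λ i → comb (λ j → a (combine {s} {t} i j)) ψ y) i coeff≉0)
      where
      module CS = Counting S
      regroup : ∀ x y → π x ≈₂ y → comb a Φ x ≈ comb (λ i → comb (λ j → a (combine {s} {t} i j)) ψ y) φ x
      regroup x y πx≈y = let open SetoidReasoning setoid in begin
        sum (λ k → a k * Φ k x)
          ≈⟨ sum-combine s {t} (λ k → a k * Φ k x) ⟩
        sum (λ i → sum (λ j → a (combine {s} {t} i j) * Φ (combine {s} {t} i j) x))
          ≈⟨ sum-cong {f = λ i → sum (λ j → a (combine {s} {t} i j) * Φ (combine i j) x)} (λ i →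
                sum-cong {f = λ j → a (combine {s} {t} i j) * Φ (combine i j) x}
                  (λ j → trans (*-congˡ (Φ≈ i j πx≈y)) (swap (a (combine i j)) (φ i x) (ψ j y)))) ⟩
        sum (λ i → sum (λ j → (a (combine {s} {t} i j) * ψ j y) * φ i x))
          ≈⟨ sum-cong {f = λ i → sum (λ j → (a (combine {s} {t} i j) * ψ j y) * φ i x)}
                (λ i → sym (*-distribʳ-sum (φ i x) (λ j → a (combine {s} {t} i j) * ψ j y))) ⟩
        sum (λ i → sum (λ j → a (combine {s} {t} i j) * ψ j y) * φ i x) ∎
        where
        open CSolver
        swap : ∀ u v w → u * (v * w) ≈ (u * w) * v
        swap = solve 3 (λ u v w → u :* (v :* w) := (u :* w) :* v) refl

-- Dimension and minimum distance from a weight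

module CodeParameters {c ℓ₁ ℓ₂ : Level} {q : ℕ} (F : FiniteField c ℓ₁ ℓ₂ q) where

  open Field F
  open Codes F
  open LinearCombinations F
  open VecEquality setoid using (_≋_)
  open CountFin

  private
    distinct? : ∀ {n} (u v : Word n) → Decidable (λ i → ¬ u i ≈ v i)
    distinct? u v i = ¬? (u i ≟ v i)

  ≋-dec : ∀ {n} (u v : Word n) → Dec (u ≋ v)
  ≋-dec u v = all? λ i → u i ≟ v i

  hammingDistance-cong : ∀ {n} {u u′ v v′ : Word n} → u ≋ u′ → v ≋ v′ →
    hammingDistance u v ≡ hammingDistance u′ v′
  hammingDistance-cong {u = u} {u′} {v} {v′} u≋ v≋ = Card-unique
    (λ {i} u≉v eq → u≉v (trans (u≋ i) (trans eq (sym (v≋ i)))))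
    (λ {i} u≉v eq → u≉v (trans (sym (u≋ i)) (trans eq (v≋ i))))
    (filter-Card (distinct? u v)) (filter-Card (distinct? u′ v′))

  module _ {n s} (C : Code n) (b : Vector (Word n) s)
    (generates : ∀ w a → w ≋ linearCombination a b → w ∈ C)
    (generated : ∀ w → w ∈ C → ∃ λ a → w ≋ linearCombination a b)
    {d} (weight : ∀ (a : Vector Carrier s) j → ¬ a j ≈ 0# → AtLeast (λ i → ¬ linearCombination a b i ≈ 0#) d)
    where

    isBasis : 1 ≤ d → IsBasis C b
    isBasis 1≤d = record
      { inCode      = λ j → generates (b j) (unit j) λ i → sym (sum-unit j (λ k → b k i))
      ; independent = λ a eq j → decidable-stable (a j ≟ 0#) λ aj≉0 →
          let w = AtLeast-≤ 1≤d (weight a j aj≉0) in AtLeast.member w zero (eq (AtLeast.element w zero))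
      ; spanning    = generated
      }

    private
      word : Fin (q ℕ.^ s) → Word n
      word k = linearCombination (elt ∘ finToFun k) b

      -- Codewords are indexed by their coefficient vectors, coded as elements of `Fin (q ℕ.^ s)`.
      -- The search for a pair at a given distance is then finite, so the predicate is decidable and
      -- `least` applies.
      Distance : ℕ → Set ℓ₁
      Distance m = ∃ λ (k : Fin (q ℕ.^ s)) → ∃ λ (l : Fin (q ℕ.^ s)) →
        ¬ (word k ≋ word l) × hammingDistance (word k) (word l) ≡ m

      distance? : Decidable Distance
      distance? m = any? λ k → any? λ l →
        (¬? (≋-dec (word k) (word l))) ×-dec (hammingDistance (word k) (word l) ℕₚ.≟ m)

      code : Vector Carrier s → Fin (q ℕ.^ s)
      code a = funToFin (idx ∘ a)

      word-code : ∀ a → word (code a) ≋ linearCombination a b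
      word-code a i = sum-cong {f = λ j → elt (finToFun (code a) j) * b j i} λ j → *-congʳ
        (trans (reflexive (≡.cong elt (finToFun-funToFin (idx ∘ a) j))) (elt-idx (a j)))

      distance : ∀ {u v} → u ∈ C → v ∈ C → ¬ (u ≋ v) → Distance (hammingDistance u v)
      distance {u} {v} u∈ v∈ u≉v with a , u≋ ← generated u u∈ | a′ , v≋ ← generated v v∈ =
        code a , code a′ ,
        (λ eq → u≉v λ i → trans (sym (u≋′ i)) (trans (eq i) (v≋′ i))) ,
        hammingDistance-cong u≋′ v≋′
        where
        u≋′ : word (code a) ≋ u
        u≋′ i = trans (word-code a i) (sym (u≋ i))
        v≋′ : word (code a′) ≋ v
        v≋′ i = trans (word-code a′ i) (sym (v≋ i))

      -- Distinct words have coefficient vectors that differ at some index, found by a finite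
      -- search. The difference vector is nonzero there, and its combination is nonzero only at
      -- positions where the words differ.
      distance≥d : ∀ {u v} → u ∈ C → v ∈ C → ¬ (u ≋ v) → d ≤ hammingDistance u v
      distance≥d {u} {v} u∈ v∈ u≉v with a , u≋ ← generated u u∈ | a′ , v≋ ← generated v v∈ =
        conclude (Finₚ.¬∀⟶∃¬ s (λ j → a j ≈ a′ j) (λ j → a j ≟ a′ j) λ eq → u≉v λ i →
          trans (u≋ i) (trans (sum-cong {f = λ j → a j * b j i} λ j → *-congʳ (eq j)) (sym (v≋ i))))
        where
        e : Vector Carrier s
        e j = a j + - 1# * a′ j
        conclude : (∃ λ j → ¬ a j ≈ a′ j) → d ≤ hammingDistance u v
        conclude (j , aj≉) = AtLeast≤Card
          (λ {i} lc≉0 ui≈vi → lc≉0 (trans (comb-sub a a′ (λ j i → b j i) i)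
            (x≈y⇒x-y≈0 (trans (sym (u≋ i)) (trans ui≈vi (v≋ i))))))
          (weight e j λ ej≈0 → aj≉ (x-y≈0⇒x≈y _ _ (trans (+-congˡ (sym (-1*x≈-x (a′ j)))) ej≈0)))
          (filter-Card (distinct? u v))

    -- The descent of `least` has to start from some distance that occurs; the basis word at `j₀`
    -- and the zero word provide it.
    minimumDistance : ¬ 1# ≈ 0# → 1 ≤ d → Fin s → MinimumDistanceAtLeast C d
    minimumDistance 1≉0 1≤d j₀ = conclude (least distance? _ (distance (IsBasis.inCode (isBasis 1≤d) j₀) zero∈C b≉0))
      where
      zero∈C : (λ _ → 0#) ∈ C
      zero∈C = generates _ (λ _ → 0#) λ i → sym (sum-zero _ λ j → zeroˡ (b j i))
      b≉0 : ¬ (b j₀ ≋ λ _ → 0#)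
      b≉0 eq = 1≉0 (trans (sym (unit-diagonal j₀)) (IsBasis.independent (isBasis 1≤d) (unit j₀)
        (λ i → trans (sum-unit j₀ (λ k → b k i)) (eq i)) j₀))
      conclude : (∃ λ m → Distance m × (∀ k → Distance k → m ≤ k)) → MinimumDistanceAtLeast C d
      conclude (m , (k , l , k≉l , ≡m) , minimal) =
        m , ((word k , word l , word∈ k , word∈ l , k≉l , ≡m) ,
             λ u v u∈ v∈ u≉v → minimal _ (distance u∈ v∈ u≉v)) ,
        ≡.subst (d ≤_) ≡m (distance≥d (word∈ k) (word∈ l) k≉l)
        where
        word∈ : ∀ k → word k ∈ C
        word∈ k = generates _ (elt ∘ finToFun k) λ i → refl

-- Evaluation codes and their puncturings

module EvaluationCodes {c ℓ₁ ℓ₂ : Level} {q : ℕ} (F : FiniteField c ℓ₁ ℓ₂ q) where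

  open Field F
  open Codes F
  open Evaluation F
  open LinearCombinations F
  open Weights F
  open CodeParameters F
  open Sum semiring using (sum)
  open VecEquality setoid using (_≋_)
  open SetoidReasoning setoid

  evalMonomial-cong : ∀ m {P Q} → P ≈ₚ Q → evalMonomial m P ≈ evalMonomial m Q
  evalMonomial-cong (i , j , k) (x≈ , y≈ , z≈) =
    *-cong (*-cong (^-congˡ i x≈) (^-congˡ j y≈)) (^-congˡ k z≈)

  eval-tabulate : ∀ {s} (a : Vector Carrier s) (mon : Fin s → Monomial) P →
    eval (tabulate λ j → a j , mon j) P ≈ comb a (λ j → evalMonomial (mon j)) P
  eval-tabulate {zero}  a mon P = refl
  eval-tabulate {suc s} a mon P = +-congˡ (eval-tabulate (a ∘ suc) (mon ∘ suc) P)

  module _ {M : Pred Monomial 0ℓ} {n s} (pts : Vector Point n) (mon : Fin s → Monomial)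
    (mon∈M : ∀ j → mon j ∈ M)
    -- Coordinates that are constant on the points only contribute the factor κ.
    (reduce : ∀ m → m ∈ M → ∃ λ κ → ∃ λ j → ∀ i → evalMonomial m (pts i) ≈ κ * evalMonomial (mon j) (pts i))
    where

    -- A formal sum may repeat monomials, and `reduce` may send different monomials to one index, so
    -- each term adds its contribution to the coefficient already present there.
    eval-comb : ∀ g → g ∈ span M → ∃ λ a → ∀ i → eval g (pts i) ≈ comb a (λ j → evalMonomial (mon j)) (pts i)
    eval-comb [] [] = (λ _ → 0#) , λ i → sym (sum-zero _ λ j → zeroˡ (evalMonomial (mon j) (pts i)))
    eval-comb ((k , m) ∷ g) (m∈ ∷ g∈)
      with κ , j , eq ← reduce m m∈ | a , eq′ ← eval-comb g g∈ =
      (λ l → a l + (k * κ) * unit j l) , λ i → begin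
        k * evalMonomial m (pts i) + eval g (pts i)
          ≈⟨ +-cong (*-congˡ (eq i)) (eq′ i) ⟩
        k * (κ * φ j (pts i)) + comb a φ (pts i)
          ≈⟨ +-comm _ _ ⟩
        comb a φ (pts i) + k * (κ * φ j (pts i))
          ≈⟨ +-congˡ (trans (sym (*-assoc k κ _)) (*-congˡ (sym (sum-unit j (λ l → φ l (pts i)))))) ⟩
        comb a φ (pts i) + (k * κ) * comb (unit j) φ (pts i)
          ≈⟨ comb-linear a (unit j) (k * κ) φ (pts i) ⟨
        comb (λ l → a l + (k * κ) * unit j l) φ (pts i) ∎
      where
      φ : Fin s → Point → Carrier
      φ j = evalMonomial (mon j)

    -- `C` is tied to the evaluation code by two inclusions, which lets a puncturing take its place.
    -- `cover` turns points with nonzero value into positions, and distinct points into distinct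
    -- positions because a position determines its point.
    evaluationCode-parameters : ∀ {r} {P : Pred Point r} →
      (∀ {Q} → Q ∈ P → ∃ λ i → Q ≈ₚ pts i) →
      ∀ {d} → Weight pointSetoid P (λ j → evalMonomial (mon j)) d → ¬ 1# ≈ 0# → 1 ≤ d → Fin s →
      (C : Code n) → C ⊆ evaluationCode (span M) pts → evaluationCode (span M) pts ⊆ C →
      HasDimension C s × MinimumDistanceAtLeast C d
    evaluationCode-parameters cover {d} weight 1≉0 1≤d j₀ C C⊆ ⊆C =
      (b , isBasis C b generates generated wt 1≤d) , minimumDistance C b generates generated wt 1≉0 1≤d j₀
      where
      φ : Fin s → Point → Carrier
      φ j = evalMonomial (mon j)
      b : Vector (Word n) s
      b j i = φ j (pts i)
      generates : ∀ w a → w ≋ linearCombination a b → w ∈ C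
      generates w a w≋ = ⊆C (tabulate (λ j → a j , mon j) , Allₚ.tabulate⁺ mon∈M ,
        λ i → trans (w≋ i) (sym (eval-tabulate a mon (pts i))))
      generated : ∀ w → w ∈ C → ∃ λ a → w ≋ linearCombination a b
      generated w w∈ with g , g∈ , w≋ ← C⊆ w∈ with a , eq ← eval-comb g g∈ = a , λ i → trans (w≋ i) (eq i)
      wt : ∀ (a : Vector Carrier s) j → ¬ a j ≈ 0# → CountFin.AtLeast (λ i → ¬ linearCombination a b i ≈ 0#) d
      wt a j aj≉0 with Counting.mkAtLeast f f∈ inj ← weight a j aj≉0 = CountFin.mkAtLeast
        (λ k → proj₁ (cover (proj₁ (f∈ k))))
        (λ k eq → proj₂ (f∈ k) (trans (comb-point-cong a φ (λ j → evalMonomial-cong (mon j) (at k))) eq))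
        (λ {k} {l} eq → inj (Setoid.trans pointSetoid (at k)
          (Setoid.trans pointSetoid (Setoid.reflexive pointSetoid (≡.cong pts eq)) (Setoid.sym pointSetoid (at l)))))
        where
        at : ∀ k → f k ≈ₚ pts (proj₁ (cover (proj₁ (f∈ k))))
        at k = proj₂ (cover (proj₁ (f∈ k)))

  puncture⊆evaluationCode : ∀ {V n ℓ} {pts : Vector Point n} {S : Pred (Fin n) ℓ} (S? : Decidable S) →
    puncture (evaluationCode V pts) S? ⊆ evaluationCode V (pts ∘ lookup (positions S?))
  puncture⊆evaluationCode S? (u , (g , g∈ , u≋) , w≋) = g , g∈ , λ i → trans (w≋ i) (u≋ _)

  evaluationCode⊆puncture : ∀ {V n ℓ} {pts : Vector Point n} {S : Pred (Fin n) ℓ} (S? : Decidable S) →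
    evaluationCode V (pts ∘ lookup (positions S?)) ⊆ puncture (evaluationCode V pts) S?
  evaluationCode⊆puncture {pts = pts} S? (g , g∈ , w≋) = (λ i → eval g (pts i)) , (g , g∈ , λ i → refl) , w≋

-- Divisibility of binomial coefficients by a prime

prime∣k!⇒p≤k : ∀ {p} → Prime p → ∀ k → p ∣ k ! → p ≤ k
prime∣k!⇒p≤k pp zero    p∣1 = contradiction (∣⇒≤ p∣1)
  (ℕₚ.<⇒≱ (ℕ.nonTrivial⇒n>1 _ {{prime⇒nonTrivial pp}}))
prime∣k!⇒p≤k pp (suc k) p∣ with euclidsLemma (suc k) (k !) pp p∣
... | inj₁ p∣1+k = ∣⇒≤ p∣1+k
... | inj₂ p∣k!  = ℕₚ.m≤n⇒m≤1+n (prime∣k!⇒p≤k pp k p∣k!)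

-- The prime p divides p!, which is the binomial coefficient times k! (p - k)!, and both factorials
-- are products of numbers below p.
prime∣binomial : ∀ {p} → Prime p → ∀ {k} → 0 < k → k < p → p ∣ p choose k
prime∣binomial {p@(suc p-1)} pp {k} 0<k k<p with euclidsLemma (p choose k) (k ! ℕ.* (p ∸ k) !) pp p∣
  where
  instance _ = ℕₚ._!*_!≢0 k (p ∸ k)
  p∣ : p ∣ (p choose k) ℕ.* (k ! ℕ.* (p ∸ k) !)
  p∣ = ≡.subst (p ∣_) (≡.sym (≡.trans
    (≡.cong (ℕ._* (k ! ℕ.* (p ∸ k) !)) (nCk≡n!/k![n-k]! (ℕₚ.<⇒≤ k<p)))
    (m/n*n≡m (k![n∸k]!∣n! (ℕₚ.<⇒≤ k<p))))) (m∣m*n (p-1 !))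
... | inj₁ p∣C = p∣C
... | inj₂ p∣ with euclidsLemma (k !) ((p ∸ k) !) pp p∣
...   | inj₁ p∣k! = contradiction (prime∣k!⇒p≤k pp k p∣k!) (ℕₚ.<⇒≱ k<p)
...   | inj₂ p∣! = contradiction (prime∣k!⇒p≤k pp (p ∸ k) p∣!) (ℕₚ.<⇒≱ (ℕₚ.∸-monoʳ-< {p} {k} {0} 0<k (ℕₚ.<⇒≤ k<p)))

module _ {a ℓ} (M : CommutativeMonoid a ℓ) where
  open CommutativeMonoid M
  open CMSum M

  sum-single : ∀ {n} (i : Fin n) (t : Vector Carrier n) → (∀ j → j ≢ i → t j ≈ ε) → sum t ≈ t i
  sum-single {suc n} i t t≈ε = trans (sum-remove {i = i} t) (trans
    (∙-congˡ (trans (sum-cong-≋ {x = λ j → t (punchIn i j)} {λ _ → ε} λ j → t≈ε (punchIn i j) (punchInᵢ≢i i j))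
      (sum-replicate-zero n)))
    (identityʳ (t i)))

-- The additive order of 1 and the identity x^q = x

module FiniteFields {c ℓ₁ ℓ₂ : Level} {q : ℕ} (F : FiniteField c ℓ₁ ℓ₂ q) where

  open Field F
  open Mult semiring using () renaming (_×_ to _·_)
  module Σ⁺ = CMSum +-commutativeMonoid
  module Π = CMSum *-commutativeMonoid
  open CExp commutativeSemiring using (^-distrib-*) public
  open Counting setoid
  open SetoidReasoning setoid

  Card-field : Card (λ _ → ⊤) q
  Card-field = mkCard (mkAtLeast elt (λ _ → tt)
    λ {i} {j} eq → ≡.trans (≡.sym (idx-elt i)) (≡.trans (Inverse.to-cong enumeration eq) (idx-elt j)))
    λ {x} _ → idx x , sym (elt-idx x)

  idx-cong : ∀ {x y} → x ≈ y → idx x ≡ idx y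
  idx-cong {x} {y} x≈y = Card.injective Card-field (trans (elt-idx x) (trans x≈y (sym (elt-idx y))))

  relabel : (f g : Carrier → Carrier) → (∀ {x y} → x ≈ y → f x ≈ f y) → (∀ {x y} → x ≈ y → g x ≈ g y) →
    (∀ x → f (g x) ≈ x) → (∀ x → g (f x) ≈ x) → Permutation q q
  relabel f g f-cong g-cong fg gf = permutation (idx ∘ f ∘ elt) (idx ∘ g ∘ elt)
    (λ i → ≡.trans (idx-cong (trans (f-cong (elt-idx _)) (fg _))) (idx-elt i))
    (λ i → ≡.trans (idx-cong (trans (g-cong (elt-idx _)) (gf _))) (idx-elt i))

  -- Adding 1 permutes the field, so the sum of all elements does not change
  -- when 1 is added to each of them.
  q·1≈0 : q · 1# ≈ 0#
  q·1≈0 = begin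
    q · 1#                    ≈⟨ +-identityʳ _ ⟨
    q · 1# + 0#               ≈⟨ +-congˡ (-‿inverseʳ s) ⟨
    q · 1# + (s - s)          ≈⟨ +-assoc _ _ _ ⟨
    (q · 1# + s) - s          ≈⟨ +-congʳ (trans (+-comm _ _) s+q≈s) ⟩
    s - s                     ≈⟨ -‿inverseʳ s ⟩
    0#                        ∎
    where
    s = Σ⁺.sum elt
    π = relabel (_+ 1#) (_- 1#) +-congʳ +-congʳ
      (λ x → trans (+-assoc x _ _) (trans (+-congˡ (-‿inverseˡ 1#)) (+-identityʳ x)))
      (λ x → trans (+-assoc x _ _) (trans (+-congˡ (-‿inverseʳ 1#)) (+-identityʳ x)))
    s+q≈s : s + q · 1# ≈ s
    s+q≈s = begin
      s + q · 1#                            ≈⟨ +-congˡ (Σ⁺.sum-replicate q) ⟨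
      s + Σ⁺.sum {q} (λ _ → 1#)             ≈⟨ Σ⁺.∑-distrib-+ elt (λ _ → 1#) ⟨
      Σ⁺.sum (λ i → elt i + 1#)             ≈⟨ Σ⁺.sum-cong-≋ {x = λ i → elt i + 1#} (λ i → sym (elt-idx (elt i + 1#))) ⟩
      Σ⁺.sum (λ i → elt (idx (elt i + 1#))) ≈⟨ Σ⁺.sum-permute elt π ⟨
      s                                     ∎

  product-nonzero : ¬ 1# ≈ 0# → ∀ {n} (f : Fin n → Carrier) → (∀ i → ¬ f i ≈ 0#) → ¬ Π.sum f ≈ 0#
  product-nonzero 1≉0 {zero}  f f≉0 = 1≉0
  product-nonzero 1≉0 {suc n} f f≉0 = *-nonzero (f≉0 zero) (product-nonzero 1≉0 (f ∘ suc) (f≉0 ∘ suc))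

  private
    -- With 0 replaced by 1, the product of the nonzero elements can be taken over the whole of
    -- `Fin q` and stays nonzero.
    nonzeroPart : Carrier → Carrier
    nonzeroPart y with y ≟ 0#
    ... | yes _ = 1#
    ... | no  _ = y

    atZero : Carrier → Carrier → Carrier
    atZero x y with y ≟ 0#
    ... | yes _ = x
    ... | no  _ = 1#

    nonzeroPart-cong : ∀ {x y} → x ≈ y → nonzeroPart x ≈ nonzeroPart y
    nonzeroPart-cong {x} {y} x≈y with x ≟ 0# | y ≟ 0#
    ... | yes _   | yes _   = refl
    ... | yes x≈0 | no y≉0  = contradiction (trans (sym x≈y) x≈0) y≉0
    ... | no x≉0  | yes y≈0 = contradiction (trans x≈y y≈0) x≉0
    ... | no _    | no _    = x≈y

    nonzeroPart-nonzero : ¬ 1# ≈ 0# → ∀ x → ¬ nonzeroPart x ≈ 0#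
    nonzeroPart-nonzero 1≉0 x with x ≟ 0#
    ... | yes _  = 1≉0
    ... | no x≉0 = x≉0

    -- Only y = 0 breaks multiplicativity: there the left product has lost a factor x, which
    -- `atZero` restores.
    nonzeroPart-* : ∀ {x} → ¬ x ≈ 0# → ∀ y → nonzeroPart (x * y) * atZero x y ≈ x * nonzeroPart y
    nonzeroPart-* {x} x≉0 y with y ≟ 0# | x * y ≟ 0#
    ... | yes _   | yes _    = *-comm _ _
    ... | yes y≈0 | no xy≉0  = contradiction (trans (*-congˡ y≈0) (zeroʳ x)) xy≉0
    ... | no y≉0  | yes xy≈0 = contradiction (x*y≈0⇒y≈0 x≉0 xy≈0) y≉0
    ... | no _    | no _     = *-identityʳ _

  -- The element of `Fin n` serves as evidence that the exponent is positive.
  zero-^ : ∀ {n x} → Fin n → x ≈ 0# → x ^ n ≈ 0#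
  zero-^ {suc n} _ x≈0 = trans (*-congʳ x≈0) (zeroˡ _)

  -- Multiplication by x ≠ 0 permutes the field and its nonzero elements; the
  -- factor `atZero` lets all q factors be scaled, giving x ^ q, not x ^ (q ∸ 1).
  x^q≈x : ¬ 1# ≈ 0# → ∀ x → x ^ q ≈ x
  x^q≈x 1≉0 x with x ≟ 0#
  ... | yes x≈0 = trans (zero-^ (idx x) x≈0) (sym x≈0)
  ... | no x≉0 with y , xy≈1 ← inverse x x≉0 = *-cancelˡ (product-nonzero 1≉0 h (λ i → nonzeroPart-nonzero 1≉0 (elt i))) (begin
    Π.sum h * x ^ q                                            ≈⟨ *-comm _ _ ⟩
    x ^ q * Π.sum h                                            ≈⟨ *-congʳ (Π.sum-replicate q) ⟨
    Π.sum {q} (λ _ → x) * Π.sum h                              ≈⟨ Π.∑-distrib-+ (λ _ → x) h ⟨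
    Π.sum (λ i → x * h i)                                      ≈⟨ Π.sum-cong-≋ {x = λ i → x * h i} (λ i → sym (nonzeroPart-* x≉0 (elt i))) ⟩
    Π.sum (λ i → nonzeroPart (x * elt i) * atZero x (elt i))   ≈⟨ Π.∑-distrib-+ (λ i → nonzeroPart (x * elt i)) _ ⟩
    Π.sum (λ i → nonzeroPart (x * elt i)) * Π.sum (λ i → atZero x (elt i))
      ≈⟨ *-cong (Π.sum-cong-≋ {x = λ i → nonzeroPart (x * elt i)} (λ i → nonzeroPart-cong (sym (elt-idx _))))
           (sum-single *-commutativeMonoid (idx 0#) (λ i → atZero x (elt i)) away) ⟩
    Π.sum (λ i → h (idx (x * elt i))) * atZero x (elt (idx 0#)) ≈⟨ *-cong (sym (Π.sum-permute h π)) at0 ⟩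
    Π.sum h * x                                                ∎)
    where
    h : Fin q → Carrier
    h i = nonzeroPart (elt i)
    π = relabel (x *_) (y *_) *-congˡ *-congˡ
      (λ z → trans (sym (*-assoc x y z)) (trans (*-congʳ xy≈1) (*-identityˡ z)))
      (λ z → trans (sym (*-assoc y x z)) (trans (*-congʳ (trans (*-comm y x) xy≈1)) (*-identityˡ z)))
    at0 : atZero x (elt (idx 0#)) ≈ x
    at0 with elt (idx 0#) ≟ 0#
    ... | yes _ = refl
    ... | no ≉0 = contradiction (elt-idx 0#) ≉0
    away : ∀ j → j ≢ idx 0# → atZero x (elt j) ≈ 1#
    away j j≢ with elt j ≟ 0#
    ... | yes ≈0 = contradiction (≡.trans (≡.sym (idx-elt j)) (idx-cong ≈0)) j≢
    ... | no _   = refl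

-- Frobenius, prime field and trace in the field of p² elements

module PrimeSquareFields {c ℓ₁ ℓ₂ : Level} (p : ℕ) (p-prime : Prime p) (2∤p : 2 ∤ p)
  (F : FiniteField c ℓ₁ ℓ₂ (p ℕ.^ 2)) where

  open Field F
  open FiniteFields F
  open Mult semiring using (×1-homo-*; ×-homo-+; ×-assoc-*) renaming (_×_ to _·_; ×-congʳ to ·-congʳ; ×-congˡ to ·-congˡ)
  open Counting setoid
  open Weights F
  open SetoidReasoning setoid

  1<p : 1 < p
  1<p = ℕ.nonTrivial⇒n>1 p {{prime⇒nonTrivial p-prime}}

  2<p : 2 < p
  2<p = ℕₚ.≤∧≢⇒< 1<p λ { ≡.refl → 2∤p ∣-refl }

  Fin-p : Fin p
  Fin-p = fromℕ< (ℕₚ.<⇒≤ 1<p)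

  p<p² : p < p ℕ.^ 2
  p<p² = ≡.subst (p <_) (≡.cong (p ℕ.*_) (≡.sym (ℕₚ.*-identityʳ p)))
    (ℕₚ.m<m*n p p {{prime⇒nonZero p-prime}} 1<p)

  -- By cardinality: if 1 = 0, every element equals 0, but there are p² > 1 elements.
  1≉0 : ¬ 1# ≈ 0#
  1≉0 1≈0 = ℕₚ.<⇒≱ (ℕₚ.<-trans 1<p p<p²) (AtLeast≤Card id (Card.atLeast Card-field)
    (Card-singleton {x = 0#} tt λ {y} _ → trans (sym (*-identityˡ y)) (trans (*-congʳ 1≈0) (zeroˡ y))))

  x^p²≈x : ∀ x → (x ^ p) ^ p ≈ x
  x^p²≈x x = trans (^-assocʳ x p p)
    (trans (^-congʳ x (≡.cong (p ℕ.*_) (≡.sym (ℕₚ.*-identityʳ p)))) (x^q≈x 1≉0 x))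

  -- The square of p · 1 is p² · 1 = 0, and there are no zero divisors.
  p·1≈0 : p · 1# ≈ 0#
  p·1≈0 with x*y≈0⇒x≈0⊎y≈0 (trans (sym (×1-homo-* p p))
    (trans (·-congˡ (≡.cong (p ℕ.*_) (≡.sym (ℕₚ.*-identityʳ p)))) q·1≈0))
  ... | inj₁ eq = eq
  ... | inj₂ eq = eq

  p∣n⇒n·1≈0 : ∀ {n} → p ∣ n → n · 1# ≈ 0#
  p∣n⇒n·1≈0 (divides k ≡.refl) = trans (×1-homo-* k p) (trans (*-congˡ p·1≈0) (zeroʳ _))

  -- As k and p are coprime, Bézout makes 1 the difference of a multiple of k and a multiple of p,
  -- both of which would become 0 in the field. The two cases are the two signs of that difference
  -- in the natural numbers.
  k·1≉0 : ∀ {k} → 0 < k → k < p → ¬ k · 1# ≈ 0#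
  k·1≉0 {k} 0<k k<p k·1≈0 with coprime-Bézout (prime⇒coprime p-prime {{ℕ.>-nonZero 0<k}} k<p)
  ... | Bézout.+- x y eq = 1≉0 (begin
    1#                                     ≈⟨ +-identityʳ 1# ⟨
    1# + 0#                                ≈⟨ +-congˡ (trans (×1-homo-* y k) (trans (*-congˡ k·1≈0) (zeroʳ _))) ⟨
    1# + (y ℕ.* k) · 1#                    ≈⟨ ·-congˡ eq ⟩
    (x ℕ.* p) · 1#                         ≈⟨ p∣n⇒n·1≈0 (divides x ≡.refl) ⟩
    0#                                     ∎)
  ... | Bézout.-+ x y eq = 1≉0 (begin
    1#                                     ≈⟨ +-identityʳ 1# ⟨
    1# + 0#                                ≈⟨ +-congˡ (p∣n⇒n·1≈0 (divides x ≡.refl)) ⟨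
    1# + (x ℕ.* p) · 1#                    ≈⟨ ·-congˡ eq ⟩
    (y ℕ.* k) · 1#                         ≈⟨ trans (×1-homo-* y k) (trans (*-congˡ k·1≈0) (zeroʳ _)) ⟩
    0#                                     ∎)

  -- The binomial theorem with all inner terms zero. Writing the exponent as a successor exposes the
  -- first and the last term of the sum, and `frobenius-+` gets this shape by matching on a number
  -- equal to p.
  additive-power : ∀ n → (∀ k → 0 < k → k < suc n → (suc n choose k) · 1# ≈ 0#) →
    ∀ x y → (x + y) ^ suc n ≈ x ^ suc n + y ^ suc n
  additive-power n C≈0 x y = begin
    (x + y) ^ suc n                                 ≈⟨ Binomial.theorem commutativeSemiring (suc n) x y ⟩
    t zero + Σ⁺.sum (t ∘ suc)                       ≈⟨ +-cong t₀ (Σ⁺.sum-init-last (t ∘ suc)) ⟩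
    y ^ suc n + (Σ⁺.sum (λ i → t (suc (inject₁ i))) + t (suc (fromℕ n)))
      ≈⟨ +-congˡ (+-cong (trans (Σ⁺.sum-cong-≋ {x = λ i → t (suc (inject₁ i))} {λ _ → 0#} middle)
           (Σ⁺.sum-replicate-zero n)) tₙ) ⟩
    y ^ suc n + (0# + x ^ suc n)                    ≈⟨ +-congˡ (+-identityˡ _) ⟩
    y ^ suc n + x ^ suc n                           ≈⟨ +-comm _ _ ⟩
    x ^ suc n + y ^ suc n                           ∎
    where
    t : Fin (suc (suc n)) → Carrier
    t = Binomial.binomialTerm commutativeSemiring x y (suc n)
    t₀ : t zero ≈ y ^ suc n
    t₀ = trans (+-identityʳ _) (*-identityˡ _)
    tₙ : t (suc (fromℕ n)) ≈ x ^ suc n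
    tₙ rewrite toℕ-fromℕ n | nCn≡1 (suc n) | ℕₚ.n∸n≡0 n = trans (+-identityʳ _) (*-identityʳ _)
    middle : ∀ i → t (suc (inject₁ i)) ≈ 0#
    middle i = begin
      N · b               ≈⟨ ·-congʳ N (*-identityˡ b) ⟨
      N · (1# * b)        ≈⟨ ×-assoc-* N 1# b ⟨
      (N · 1#) * b        ≈⟨ *-congʳ (C≈0 _ (s≤s z≤n) (s≤s (≡.subst (_< n) (≡.sym (toℕ-inject₁ i)) (toℕ<n i)))) ⟩
      0# * b              ≈⟨ zeroˡ b ⟩
      0#                  ∎
      where
      N = suc n choose suc (toℕ (inject₁ i))
      b = Binomial.binomial commutativeSemiring x y (suc n) (suc (inject₁ i))

  frobenius-+ : ∀ x y → (x + y) ^ p ≈ x ^ p + y ^ p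
  frobenius-+ = at-suc p ≡.refl
    where
    at-suc : ∀ n → n ≡ p → ∀ x y → (x + y) ^ n ≈ x ^ n + y ^ n
    at-suc zero    ≡.refl = contradiction 1<p λ ()
    at-suc (suc n) ≡.refl = additive-power n λ k 0<k k<p → p∣n⇒n·1≈0 (prime∣binomial p-prime 0<k k<p)

  0^p≈0 : 0# ^ p ≈ 0#
  0^p≈0 = zero-^ Fin-p refl

  1^p≈1 : 1# ^ p ≈ 1#
  1^p≈1 = 1^n≈1 p
    where
    1^n≈1 : ∀ n → 1# ^ n ≈ 1#
    1^n≈1 zero    = refl
    1^n≈1 (suc n) = trans (*-identityˡ _) (1^n≈1 n)

  frobenius-neg : ∀ x → (- x) ^ p ≈ - (x ^ p)
  frobenius-neg x = x+y≈0⇒y≈-x (x ^ p) ((- x) ^ p)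
    (trans (sym (frobenius-+ x (- x))) (trans (^-congˡ p (-‿inverseʳ x)) 0^p≈0))

  frobenius-* : ∀ x y → (x * y) ^ p ≈ x ^ p * y ^ p
  frobenius-* x y = ^-distrib-* x y p

  InPrimeField : Pred Carrier ℓ₁
  InPrimeField x = x ^ p ≈ x

  TraceZero : Pred Carrier ℓ₁
  TraceZero x = x + x ^ p ≈ 0#

  k·1∈primeField : ∀ k → InPrimeField (k · 1#)
  k·1∈primeField zero    = 0^p≈0
  k·1∈primeField (suc k) = trans (frobenius-+ 1# (k · 1#)) (+-cong 1^p≈1 (k·1∈primeField k))

  multiples : AtLeast InPrimeField p
  multiples = mkAtLeast (λ i → toℕ i · 1#) (λ i → k·1∈primeField (toℕ i)) inj
    where
    ordered : ∀ {k l} → k < l → l < p → ¬ k · 1# ≈ l · 1#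
    ordered {k} {l} k<l l<p eq = k·1≉0 (ℕₚ.m<n⇒0<n∸m k<l) (ℕₚ.≤-<-trans (ℕₚ.m∸n≤m l k) l<p)
      (trans (sym (+-identityˡ _)) (trans (+-congʳ (sym (-‿inverseˡ (k · 1#)))) (trans (+-assoc _ _ _)
        (trans (+-congˡ (trans (sym (×-homo-+ 1# k (l ∸ k)))
          (trans (·-congˡ (ℕₚ.m+[n∸m]≡n (ℕₚ.<⇒≤ k<l))) (sym eq)))) (-‿inverseˡ (k · 1#))))))
    inj : ∀ {i j : Fin p} → toℕ i · 1# ≈ toℕ j · 1# → i ≡ j
    inj {i} {j} eq with ℕₚ.<-cmp (toℕ i) (toℕ j)
    ... | tri< i<j _ _ = contradiction eq (ordered i<j (toℕ<n j))
    ... | tri≈ _ i≡j _ = toℕ-injective i≡j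
    ... | tri> _ _ j<i = contradiction (sym eq) (ordered j<i (toℕ<n i))

  -- A root of x^p − x besides the p multiples of 1 would be one too many.
  primeField⇒multiple : ∀ {x} → InPrimeField x → ∃ λ (i : Fin p) → x ≈ toℕ i · 1#
  primeField⇒multiple {x} x∈ with any? (λ (i : Fin p) → x ≟ toℕ i · 1#)
  ... | yes found = found
  ... | no none = contradiction (AtLeast.member nonroot zero) λ (y∈ , ≉0) → ≉0 (poly y∈)
    where
    open LinearCombinations F
    roots : AtLeast InPrimeField (suc p)
    roots = AtLeast-⊎ {P = λ y → InPrimeField y × y ≈ x} {Q = λ y → ∃ λ i → y ≈ toℕ i · 1#}
      proj₁ (λ (i , y≈) → trans (^-congˡ p y≈) (trans (k·1∈primeField (toℕ i)) (sym y≈)))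
      (λ (_ , y≈x) (i , z≈) y≈z → none (i , trans (sym y≈x) (trans y≈z z≈)))
      (Card.atLeast (Card-singleton (x∈ , refl) proj₂))
      (Card.atLeast (AtLeast⇒Card multiples))
    p′ one : Fin (suc p)
    p′ = fromℕ p
    one = suc Fin-p
    coeff : Fin (suc p) → Carrier
    coeff i = unit p′ i + - 1# * unit one i
    one≡1 : toℕ one ≡ 1
    one≡1 = ≡.cong suc (Finₚ.toℕ-fromℕ< _)
    p′≢one : one ≢ p′
    p′≢one eq = ℕₚ.<⇒≢ 1<p (≡.trans (≡.sym one≡1) (≡.trans (≡.cong toℕ eq) (toℕ-fromℕ p)))
    leading : ¬ coeff p′ ≈ 0#
    leading eq = 1≉0 (begin
      1#                            ≈⟨ +-identityʳ 1# ⟨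
      1# + 0#                       ≈⟨ +-cong (unit-diagonal p′) (zeroʳ _) ⟨
      unit p′ p′ + - 1# * 0#        ≈⟨ +-congˡ (*-congˡ (unit-off-diagonal one p′ p′≢one)) ⟨
      coeff p′                      ≈⟨ eq ⟩
      0#                            ∎)
    φ : Fin (suc p) → Carrier → Carrier
    φ i y = y ^ toℕ i
    poly : ∀ {y} → InPrimeField y → comb coeff φ y ≈ 0#
    poly {y} y∈ = trans (comb-sub (unit p′) (unit one) φ y) (x≈y⇒x-y≈0 (begin
      comb (unit p′) φ y    ≈⟨ sum-unit p′ (λ i → φ i y) ⟩
      y ^ toℕ p′            ≈⟨ ^-congʳ y (toℕ-fromℕ p) ⟩
      y ^ p                 ≈⟨ y∈ ⟩
      y                     ≈⟨ *-identityʳ y ⟨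
      y ^ 1                 ≈⟨ ^-congʳ y one≡1 ⟨
      y ^ toℕ one           ≈⟨ sum-unit one (λ i → φ i y) ⟨
      comb (unit one) φ y   ∎))
    nonroot : AtLeast (λ y → InPrimeField y × ¬ comb coeff φ y ≈ 0#) 1
    nonroot = power-weight setoid id id roots (AtLeast.injective roots) ℕₚ.≤-refl coeff p′ leading

  Card-primeField : Card InPrimeField p
  Card-primeField = mkCard multiples primeField⇒multiple

  -- As p < p², some x is moved by Frobenius. Then x^p - x is nonzero, and Frobenius changes its
  -- sign because x^(p²) = x.
  traceZero-generator : ∃ λ e → ¬ e ≈ 0# × TraceZero e
  traceZero-generator with any? (λ i → ¬? (elt i ^ p ≟ elt i))
  ... | no none = contradiction
          (AtLeast≤Card (λ {x} _ → decidable-stable (x ^ p ≟ x) λ x∉ → none (idx x , λ eq → x∉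
            (trans (^-congˡ p (sym (elt-idx x))) (trans eq (elt-idx x)))))
            (Card.atLeast Card-field) Card-primeField)
          (ℕₚ.<⇒≱ p<p²)
  ... | yes (i , x∉) = x ^ p - x , (λ eq → x∉ (x-y≈0⇒x≈y _ _ eq)) , (begin
    (X - x) + (X - x) ^ p        ≈⟨ +-congˡ (trans (frobenius-+ X (- x)) (+-cong (x^p²≈x x) (frobenius-neg x))) ⟩
    (X - x) + (x - X)            ≈⟨ solve 4 (λ a b c d → (a :+ b) :+ (c :+ d) := (a :+ d) :+ (c :+ b)) refl X (- x) x (- X) ⟩
    (X - X) + (x - x)            ≈⟨ +-cong (-‿inverseʳ X) (-‿inverseʳ x) ⟩
    0# + 0#                      ≈⟨ +-identityʳ 0# ⟩
    0#                           ∎)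
    where
    open CSolver
    x = elt i
    X = elt i ^ p

  -- For the generator e one has e^p = - e, so e · u has trace zero exactly when u^p = u: the
  -- elements of trace zero are e times the prime field.
  Card-traceZero : Card TraceZero p
  Card-traceZero with e , e≉0 , e∈ ← traceZero-generator with w , ew≈1 ← inverse e e≉0 =
    Card-map setoid setoid (e *_) member (*-cancelˡ e≉0) preimage *-congˡ Card-primeField
    where
    open Bundle using (Card-map)
    E = e ^ p
    W = w ^ p
    member : ∀ {u} → InPrimeField u → TraceZero (e * u)
    member {u} u∈ = begin
      e * u + (e * u) ^ p     ≈⟨ +-congˡ (trans (frobenius-* e u) (*-congˡ u∈)) ⟩
      e * u + E * u           ≈⟨ distribʳ u e E ⟨
      (e + E) * u             ≈⟨ trans (*-congʳ e∈) (zeroˡ u) ⟩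
      0#                      ∎
    EW≈1 : E * W ≈ 1#
    EW≈1 = trans (sym (frobenius-* e w)) (trans (^-congˡ p ew≈1) 1^p≈1)
    preimage : ∀ {x} → TraceZero x → ∃ λ u → InPrimeField u × x ≈ e * u
    preimage {x} x∈ = w * x ,
      trans (frobenius-* w x) (*-cancelˡ {E} E≉0 (begin
        E * (W * X)                 ≈⟨ trans (sym (*-assoc E W X)) (trans (*-congʳ EW≈1) (*-identityˡ X)) ⟩
        X                           ≈⟨ x+y≈0⇒y≈-x x X x∈ ⟩
        - x                         ≈⟨ -‿cong (trans (*-congʳ ew≈1) (*-identityˡ x)) ⟨
        - (e * w * x)               ≈⟨ -‿cong (*-assoc e w x) ⟩
        - (e * (w * x))             ≈⟨ -‿distribˡ-* e (w * x) ⟩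
        - e * (w * x)               ≈⟨ *-congʳ (x+y≈0⇒y≈-x e E e∈) ⟨
        E * (w * x)                 ∎)) ,
      trans (sym (trans (*-congʳ ew≈1) (*-identityˡ x))) (*-assoc e w x)
      where
      X = x ^ p
      E≉0 : ¬ E ≈ 0#
      E≉0 E≈0 = 1≉0 (trans (sym EW≈1) (trans (*-congʳ E≈0) (zeroˡ W)))

  -- Oddness of p makes 2 invertible, and the inverse of 2 is fixed by Frobenius because 2 is.
  -- Halving is what solves y^p - y = t explicitly.
  half : ∃ λ h → InPrimeField h × h + h ≈ 1#
  half with h , 2h≈1 ← inverse (2 · 1#) (k·1≉0 (s≤s z≤n) 2<p) =
    h ,
    *-cancelˡ (k·1≉0 (s≤s z≤n) 2<p) (begin
      2 · 1# * h ^ p          ≈⟨ *-congʳ (k·1∈primeField 2) ⟨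
      (2 · 1#) ^ p * h ^ p    ≈⟨ frobenius-* (2 · 1#) h ⟨
      (2 · 1# * h) ^ p        ≈⟨ ^-congˡ p 2h≈1 ⟩
      1# ^ p                  ≈⟨ 1^p≈1 ⟩
      1#                      ≈⟨ 2h≈1 ⟨
      2 · 1# * h              ∎) ,
    trans (sym (trans (distribʳ h 1# (1# + 0#)) (+-cong (*-identityˡ h)
      (trans (*-congʳ (+-identityʳ 1#)) (*-identityˡ h))))) 2h≈1

-- The points of the surface and their number

module SurfacePoints {c ℓ₁ ℓ₂ : Level} (p : ℕ) (p-prime : Prime p) (2∤p : 2 ∤ p)
  (F : FiniteField c ℓ₁ ℓ₂ (p ℕ.^ 2)) where

  open Field F
  open FiniteFields F
  open PrimeSquareFields p p-prime 2∤p F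
  open Mult semiring using () renaming (_×_ to _·_)
  open Evaluation F
  open Surface p F
  open Counting setoid
  open Bundle using (Card-map; Card-bundle)
  open SetoidReasoning setoid
  module CP = Counting pointSetoid

  rhs : Carrier → Carrier → Carrier
  rhs x z = x ^ (p ℕ.+ 1) * z ^ 2 + x ^ 2 * z ^ (p ℕ.+ 1)

  OnFirstLine OnSecondLine : Carrier → Pred Carrier ℓ₁
  OnFirstLine  z x = x ^ p * z + x * z ^ p ≈ 0#
  OnSecondLine z x = x * z + x ^ p * z ^ p ≈ 0#

  Admissible : Carrier → Pred Carrier ℓ₁
  Admissible z x = OnFirstLine z x ⊎ OnSecondLine z x

  ^-suc′ : ∀ x → x ^ (p ℕ.+ 1) ≈ x ^ p * x
  ^-suc′ x = trans (^-homo-* x p 1) (*-congˡ (*-identityʳ x))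

  square : ∀ x → x ^ 2 ≈ x * x
  square x = *-congˡ (*-identityʳ x)

  rhs-expand : ∀ x z → rhs x z ≈ x ^ p * x * (z * z) + x * x * (z ^ p * z)
  rhs-expand x z = +-cong (*-cong (^-suc′ x) (square z)) (*-cong (square x) (^-suc′ z))

  -- Frobenius exchanges x with X = x^p and z with Z = z^p, since applying it twice is the identity.
  rhs-frobenius : ∀ x z → rhs x z ^ p ≈ x * x ^ p * (z ^ p * z ^ p) + x ^ p * x ^ p * (z * z ^ p)
  rhs-frobenius x z = begin
    rhs x z ^ p                                           ≈⟨ ^-congˡ p (rhs-expand x z) ⟩
    (X * x * (z * z) + x * x * (Z * z)) ^ p               ≈⟨ frobenius-+ _ _ ⟩
    (X * x * (z * z)) ^ p + (x * x * (Z * z)) ^ p         ≈⟨ +-cong (frobenius-** X x z z) (frobenius-** x x Z z) ⟩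
    X ^ p * X * (Z * Z) + X * X * (Z ^ p * Z)             ≈⟨ +-cong (*-congʳ (*-congʳ (x^p²≈x x))) (*-congˡ (*-congʳ (x^p²≈x z))) ⟩
    x * X * (Z * Z) + X * X * (z * Z)                     ∎
    where
    X = x ^ p
    Z = z ^ p
    frobenius-** : ∀ a b c d → (a * b * (c * d)) ^ p ≈ a ^ p * b ^ p * (c ^ p * d ^ p)
    frobenius-** a b c d = trans (frobenius-* (a * b) (c * d)) (*-cong (frobenius-* a b) (frobenius-* c d))

  -- Once Frobenius has been applied, the factorisation is an identity in four independent variables
  -- x, X, z, Z and involves no subtraction.
  trace-rhs : ∀ x z → rhs x z + rhs x z ^ p ≈ (x ^ p * z + x * z ^ p) * (x * z + x ^ p * z ^ p)
  trace-rhs x z = trans (+-cong (rhs-expand x z) (rhs-frobenius x z)) (factor x (x ^ p) z (z ^ p))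
    where
    open CSolver
    factor : ∀ x X z Z → (X * x * (z * z) + x * x * (Z * z)) + (x * X * (Z * Z) + X * X * (z * Z))
                       ≈ (X * z + x * Z) * (x * z + X * Z)
    factor = solve 4 (λ x X z Z →
      (X :* x :* (z :* z) :+ x :* x :* (Z :* z)) :+ (x :* X :* (Z :* Z) :+ X :* X :* (z :* Z))
      := (X :* z :+ x :* Z) :* (x :* z :+ X :* Z)) refl

  interchange-minus : ∀ a b → (a - b) + (b - a) ≈ 0#
  interchange-minus a b = begin
    (a - b) + (b - a)       ≈⟨ solve 4 (λ a b′ b a′ → (a :+ b′) :+ (b :+ a′) := (a :+ a′) :+ (b :+ b′)) refl a (- b) b (- a) ⟩
    (a - a) + (b - b)       ≈⟨ +-cong (-‿inverseʳ a) (-‿inverseʳ b) ⟩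
    0# + 0#                 ≈⟨ +-identityʳ 0# ⟩
    0#                      ∎
    where open CSolver

  OnSurface⇒Admissible : ∀ {x y z} → OnSurface (x , y , z) → Admissible z x
  OnSurface⇒Admissible {x} {y} {z} on = x*y≈0⇒x≈0⊎y≈0 (begin
    (x ^ p * z + x * z ^ p) * (x * z + x ^ p * z ^ p)   ≈⟨ trace-rhs x z ⟨
    rhs x z + rhs x z ^ p                               ≈⟨ +-cong on (^-congˡ p on) ⟨
    (y ^ p - y) + (y ^ p - y) ^ p
      ≈⟨ +-congˡ (trans (frobenius-+ _ _) (+-cong (x^p²≈x y) (frobenius-neg y))) ⟩
    (y ^ p - y) + (y - y ^ p)                           ≈⟨ interchange-minus (y ^ p) y ⟩
    0#                                                  ∎)

  -- Additive Hilbert 90: an element t of trace zero is yᵖ − y for y = − t / 2.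
  Admissible⇒OnSurface : ∀ {x z} → Admissible z x → ∃ λ y → OnSurface (x , y , z)
  Admissible⇒OnSurface {x} {z} adm with h , h^p≈h , 2h≈1 ← half = - (h * t) , (begin
    (- (h * t)) ^ p - - (h * t)     ≈⟨ +-cong (frobenius-neg (h * t)) (-‿involutive (h * t)) ⟩
    - (h * t) ^ p + h * t           ≈⟨ +-congʳ (-‿cong (trans (frobenius-* h t) (*-cong h^p≈h (x+y≈0⇒y≈-x t (t ^ p) t∈)))) ⟩
    - (h * - t) + h * t             ≈⟨ +-congʳ (trans (-‿distribʳ-* h (- t)) (*-congˡ (-‿involutive t))) ⟩
    h * t + h * t                   ≈⟨ distribʳ t h h ⟨
    (h + h) * t                     ≈⟨ trans (*-congʳ 2h≈1) (*-identityˡ t) ⟩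
    t                               ∎)
    where
    t = rhs x z
    t∈ : TraceZero t
    t∈ = trans (trace-rhs x z) (product≈0 adm)
      where
      product≈0 : ∀ {a b} → a ≈ 0# ⊎ b ≈ 0# → a * b ≈ 0#
      product≈0 (inj₁ a≈0) = trans (*-congʳ a≈0) (zeroˡ _)
      product≈0 (inj₂ b≈0) = trans (*-congˡ b≈0) (zeroʳ _)

  -- Substituting x = zu turns the equation into z z^p (u + u^p) = 0, so the line is z times the set
  -- of trace zero.
  Card-firstLine : ∀ {z} → ¬ z ≈ 0# → Card (OnFirstLine z) p
  Card-firstLine {z} z≉0 with w , zw≈1 ← inverse z z≉0 =
    Card-map setoid setoid (z *_) member (*-cancelˡ z≉0) preimage *-congˡ Card-traceZero
    where
    Z = z ^ p
    Z≉0 : ¬ Z ≈ 0#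
    Z≉0 Z≈0 = z≉0 (trans (sym (x^p²≈x z)) (trans (^-congˡ p Z≈0) 0^p≈0))
    scale : ∀ u → (z * u) ^ p * z + z * u * Z ≈ z * Z * (u + u ^ p)
    scale u = trans (+-congʳ (*-congʳ (frobenius-* z u)))
      (solve 4 (λ z Z u U → Z :* U :* z :+ z :* u :* Z := z :* Z :* (u :+ U)) refl z Z u (u ^ p))
      where open CSolver
    member : ∀ {u} → TraceZero u → OnFirstLine z (z * u)
    member {u} u∈ = trans (scale u) (trans (*-congˡ u∈) (zeroʳ _))
    preimage : ∀ {x} → OnFirstLine z x → ∃ λ u → TraceZero u × x ≈ z * u
    preimage {x} x∈ = w * x , x*y≈0⇒y≈0 (*-nonzero z≉0 Z≉0) (trans (sym (scale (w * x)))
      (trans (+-cong (*-congʳ (^-congˡ p (sym x≈))) (*-congʳ (sym x≈))) x∈)) , x≈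
      where
      x≈ : x ≈ z * (w * x)
      x≈ = trans (sym (trans (*-congʳ zw≈1) (*-identityˡ x))) (*-assoc z w x)

  -- The equation says that xz has trace zero, so the line is the set of trace zero divided by z.
  Card-secondLine : ∀ {z} → ¬ z ≈ 0# → Card (OnSecondLine z) p
  Card-secondLine {z} z≉0 with w , zw≈1 ← inverse z z≉0 =
    Card-map setoid setoid (w *_) member (*-cancelˡ w≉0) preimage *-congˡ Card-traceZero
    where
    Z = z ^ p
    W = w ^ p
    w≉0 : ¬ w ≈ 0#
    w≉0 w≈0 = 1≉0 (trans (sym zw≈1) (trans (*-congˡ w≈0) (zeroʳ z)))
    ZW≈1 : Z * W ≈ 1#
    ZW≈1 = trans (sym (frobenius-* z w)) (trans (^-congˡ p zw≈1) 1^p≈1)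
    scale : ∀ u → w * u * z + (w * u) ^ p * Z ≈ u + u ^ p
    scale u = trans (+-congˡ (*-congʳ (frobenius-* w u))) (+-cong (cancel z w u zw≈1) (cancel Z W (u ^ p) ZW≈1))
      where
      cancel : ∀ z w u → z * w ≈ 1# → w * u * z ≈ u
      cancel z w u zw≈1 = trans (solve 3 (λ z w u → w :* u :* z := z :* w :* u) refl z w u)
        (trans (*-congʳ zw≈1) (*-identityˡ u))
        where open CSolver
    member : ∀ {u} → TraceZero u → OnSecondLine z (w * u)
    member {u} u∈ = trans (scale u) u∈
    preimage : ∀ {x} → OnSecondLine z x → ∃ λ u → TraceZero u × x ≈ w * u
    preimage {x} x∈ = z * x , trans (sym (scale (z * x)))
      (trans (+-cong (*-congʳ (sym x≈)) (*-congʳ (^-congˡ p (sym x≈)))) x∈) , x≈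
      where
      x≈ : x ≈ w * (z * x)
      x≈ = trans (sym (trans (*-congʳ (trans (*-comm w z) zw≈1)) (*-identityˡ x))) (*-assoc w z x)

  Special : Pred Carrier ℓ₁
  Special z = InPrimeField z ⊎ TraceZero z

  special? : Decidable Special
  special? z = (z ^ p ≟ z) ⊎-dec (z + z ^ p ≟ 0#)

  Special-cong : ∀ {x y} → x ≈ y → Special x → Special y
  Special-cong x≈y (inj₁ eq) = inj₁ (trans (^-congˡ p (sym x≈y)) (trans eq x≈y))
  Special-cong x≈y (inj₂ eq) = inj₂ (trans (+-cong (sym x≈y) (^-congˡ p (sym x≈y))) eq)

  zero-on-lines : ∀ {x} z → x ≈ 0# → OnFirstLine z x × OnSecondLine z x
  zero-on-lines {x} z x≈0 =
    trans (+-cong (*-congʳ X≈0) (*-congʳ x≈0)) (zeros z (z ^ p)) ,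
    trans (+-cong (*-congʳ x≈0) (*-congʳ X≈0)) (zeros z (z ^ p))
    where
    X≈0 = trans (^-congˡ p x≈0) 0^p≈0
    zeros : ∀ a b → 0# * a + 0# * b ≈ 0#
    zeros a b = trans (+-cong (zeroˡ a) (zeroˡ b)) (+-identityʳ 0#)

  -- If Z = z, the two equations are the same. If Z = - z, the sum of their left-hand sides is (X +
  -- x)(z + Z) = 0, so one vanishes with the other.
  special-lines : ∀ {z} → Special z → ∀ {x} → OnSecondLine z x → OnFirstLine z x
  special-lines {z} (inj₁ Z≈z) {x} on = begin
    x ^ p * z + x * z ^ p    ≈⟨ +-cong (*-congˡ (sym Z≈z)) (*-congˡ Z≈z) ⟩
    x ^ p * z ^ p + x * z    ≈⟨ +-comm _ _ ⟩
    x * z + x ^ p * z ^ p    ≈⟨ on ⟩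
    0#                       ∎
  special-lines {z} (inj₂ z+Z≈0) {x} on = begin
    X * z + x * Z                               ≈⟨ +-identityʳ _ ⟨
    (X * z + x * Z) + 0#                        ≈⟨ +-congˡ on ⟨
    (X * z + x * Z) + (x * z + X * Z)           ≈⟨ solve 4 (λ x X z Z → (X :* z :+ x :* Z) :+ (x :* z :+ X :* Z) := (X :+ x) :* (z :+ Z)) refl x X z Z ⟩
    (X + x) * (z + Z)                           ≈⟨ trans (*-congˡ z+Z≈0) (zeroʳ _) ⟩
    0#                                          ∎
    where
    open CSolver
    X = x ^ p
    Z = z ^ p

  -- As linear equations in X and x, the two conditions have determinant z² - Z². A common solution
  -- with x ≠ 0 forces it to vanish, hence Z = z or Z = - z.
  lines-meet-at-zero : ∀ {z} → ¬ Special z → ∀ {x} → OnFirstLine z x → OnSecondLine z x → x ≈ 0#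
  lines-meet-at-zero {z} ¬special {x} on₁ on₂ with x ≟ 0#
  ... | yes x≈0 = x≈0
  ... | no x≉0 = contradiction (conclude (x*y≈0⇒x≈0⊎y≈0 product≈0)) ¬special
    where
    X = x ^ p
    Z = z ^ p
    zz≈ZZ : z * z ≈ Z * Z
    zz≈ZZ = *-cancelˡ x≉0 (begin
      x * (z * z)                                 ≈⟨ +-identityʳ _ ⟨
      x * (z * z) + 0#                            ≈⟨ +-congˡ (trans (*-congʳ on₁) (zeroˡ Z)) ⟨
      x * (z * z) + (X * z + x * Z) * Z           ≈⟨ solve 4 (λ x X z Z → x :* (z :* z) :+ (X :* z :+ x :* Z) :* Z := x :* (Z :* Z) :+ (x :* z :+ X :* Z) :* z) refl x X z Z ⟩
      x * (Z * Z) + (x * z + X * Z) * z           ≈⟨ +-congˡ (trans (*-congʳ on₂) (zeroˡ z)) ⟩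
      x * (Z * Z) + 0#                            ≈⟨ +-identityʳ _ ⟩
      x * (Z * Z)                                 ∎)
      where open CSolver
    product≈0 : (z + Z) * (Z - z) ≈ 0#
    product≈0 = begin
      (z + Z) * (Z - z)                   ≈⟨ x[y-z]≈xy-xz (z + Z) Z z ⟩
      (z + Z) * Z - (z + Z) * z           ≈⟨ x≈y⇒x-y≈0 (begin
        (z + Z) * Z       ≈⟨ trans (distribʳ Z z Z) (+-congˡ (sym zz≈ZZ)) ⟩
        z * Z + z * z     ≈⟨ solve 2 (λ z Z → z :* Z :+ z :* z := (z :+ Z) :* z) refl z Z ⟩
        (z + Z) * z       ∎) ⟩
      0#                                  ∎
      where open CSolver
    conclude : z + Z ≈ 0# ⊎ Z - z ≈ 0# → Special z
    conclude (inj₁ eq) = inj₂ eq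
    conclude (inj₂ eq) = inj₁ (x-y≈0⇒x≈y Z z eq)

  firstLine? : ∀ z → Decidable (OnFirstLine z)
  firstLine? z x = x ^ p * z + x * z ^ p ≟ 0#

  firstLine-cong : ∀ {z x y} → x ≈ y → OnFirstLine z x → OnFirstLine z y
  firstLine-cong x≈y = trans (+-cong (*-congʳ (^-congˡ p (sym x≈y))) (*-congʳ (sym x≈y)))

  Card-admissible-special : ∀ {z} → ¬ z ≈ 0# → Special z → Card (Admissible z) p
  Card-admissible-special z≉0 special =
    Card-cong inj₁ (λ { (inj₁ on) → on ; (inj₂ on) → special-lines special on }) (Card-firstLine z≉0)

  Card-admissible-generic : ∀ {z} → ¬ z ≈ 0# → ¬ Special z → Card (Admissible z) (p ℕ.+ (p ∸ 1))
  Card-admissible-generic {z} z≉0 generic = Card-⊎ inj₁ (inj₂ ∘ proj₁) split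
    (λ on₁ (_ , off₁) x≈y → off₁ (firstLine-cong x≈y on₁))
    (Card-firstLine z≉0)
    -- The second line loses its single point 0 on the first one, hence `p ∸ 1`.
    (Card-complement (firstLine? z) firstLine-cong (Card-secondLine z≉0)
      (Card-singleton {x = 0#} (let on₁ , on₂ = zero-on-lines z refl in on₂ , on₁)
        λ (on₂ , on₁) → lines-meet-at-zero generic on₁ on₂))
    where
    split : ∀ {x} → Admissible z x → OnFirstLine z x ⊎ (OnSecondLine z x × ¬ OnFirstLine z x)
    split {x} (inj₁ on) = inj₁ on
    split {x} (inj₂ on) with firstLine? z x
    ... | yes on₁ = inj₁ on₁
    ... | no off₁ = inj₂ (on , off₁)

  -- The number of x-coordinates depends on whether z is special, whereas the weight argument needs
  -- one bound for all z; the first line alone provides it.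
  AtLeast-admissible : ∀ {z} → ¬ z ≈ 0# → AtLeast (Admissible z) p
  AtLeast-admissible z≉0 = AtLeast-mono inj₁ (Card.atLeast (Card-firstLine z≉0))

  Slice : Carrier → Pred Point ℓ₁
  Slice c P@(x , y , z) = InT P × z ≈ c

  FibreOver : Carrier → Carrier → Pred Point ℓ₁
  FibreOver c a P@(x , y , z) = Slice c P × x ≈ a

  OnSurface-cong : ∀ {P Q} → P ≈ₚ Q → OnSurface P → OnSurface Q
  OnSurface-cong (x≈ , y≈ , z≈) on = trans (+-cong (^-congˡ p (sym y≈)) (-‿cong (sym y≈)))
    (trans on (+-cong (*-cong (^-congˡ (p ℕ.+ 1) x≈) (^-congˡ 2 z≈)) (*-cong (^-congˡ 2 x≈) (^-congˡ (p ℕ.+ 1) z≈))))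

  InT-cong : ∀ {P Q} → P ≈ₚ Q → InT P → InT Q
  InT-cong P≈Q@(_ , _ , z≈) (on , z≉0) = OnSurface-cong P≈Q on , λ eq → z≉0 (trans z≈ eq)

  -- The Artin-Schreier map y ↦ y^p - y is additive. Hence the solutions y for fixed x and z form a
  -- coset of its kernel, the prime field, which is why a fibre consists of prime field translates.
  shifted : ∀ y u → (y + u) ^ p - (y + u) ≈ (y ^ p - y) + (u ^ p - u)
  shifted y u = begin
    (y + u) ^ p - (y + u)                   ≈⟨ +-cong (frobenius-+ y u) (sym (⁻¹-∙-comm y u)) ⟩
    (y ^ p + u ^ p) + (- y - u)             ≈⟨ solve 4 (λ Y U y u → (Y :+ U) :+ (y :+ u) := (Y :+ y) :+ (U :+ u)) refl (y ^ p) (u ^ p) (- y) (- u) ⟩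
    (y ^ p - y) + (u ^ p - u)               ∎
    where
    open CSolver
    open AbelianGroupProperties +-abelianGroup using (⁻¹-∙-comm)

  shift-surface : ∀ {a b c u} → InPrimeField u → OnSurface (a , b , c) → OnSurface (a , b + u , c)
  shift-surface {b = b} {u = u} u∈ on = trans (shifted b u)
    (trans (+-congˡ (x≈y⇒x-y≈0 u∈)) (trans (+-identityʳ _) on))

  b+[y-b]≈y : ∀ b y → b + (y - b) ≈ y
  b+[y-b]≈y b y = trans (+-congˡ (+-comm y (- b))) (trans (sym (+-assoc b (- b) y))
    (trans (+-congʳ (-‿inverseʳ b)) (+-identityˡ y)))

  difference∈primeField : ∀ {a b c y} → OnSurface (a , b , c) → OnSurface (a , y , c) → InPrimeField (y - b)
  difference∈primeField {a} {b} {c} {y} on on′ = x-y≈0⇒x≈y _ _ (begin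
    (y - b) ^ p - (y - b)                               ≈⟨ +-identityˡ _ ⟨
    0# + ((y - b) ^ p - (y - b))                        ≈⟨ +-congʳ (-‿inverseˡ (rhs a c)) ⟨
    (- rhs a c + rhs a c) + ((y - b) ^ p - (y - b))     ≈⟨ +-assoc _ _ _ ⟩
    - rhs a c + (rhs a c + ((y - b) ^ p - (y - b)))     ≈⟨ +-congˡ (+-congʳ (sym on)) ⟩
    - rhs a c + ((b ^ p - b) + ((y - b) ^ p - (y - b))) ≈⟨ +-congˡ (shifted b (y - b)) ⟨
    - rhs a c + ((b + (y - b)) ^ p - (b + (y - b)))     ≈⟨ +-congˡ (+-cong (^-congˡ p (b+[y-b]≈y b y)) (-‿cong (b+[y-b]≈y b y))) ⟩
    - rhs a c + (y ^ p - y)                             ≈⟨ +-congˡ on′ ⟩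
    - rhs a c + rhs a c                                 ≈⟨ -‿inverseˡ (rhs a c) ⟩
    0#                                                  ∎)

  Card-fibre : ∀ {c} → ¬ c ≈ 0# → ∀ a → Admissible c a → CP.Card (FibreOver c a) p
  Card-fibre {c} c≉0 a adm with b , on ← Admissible⇒OnSurface adm =
    Card-map setoid pointSetoid (λ u → a , b + u , c)
      (λ u∈ → ((shift-surface u∈ on , c≉0) , refl) , refl)
      (λ (_ , eq , _) → +-cancelˡ b eq)
      (λ { {x , y , z} (((on′ , _) , z≈c) , x≈a) → y - b ,
        difference∈primeField on (OnSurface-cong (x≈a , refl , z≈c) on′) ,
        x≈a , sym (b+[y-b]≈y b y) , z≈c })
      (λ u≈v → refl , +-congˡ u≈v , refl) Card-primeField
    where
    +-cancelˡ : ∀ b {u v} → b + u ≈ b + v → u ≈ v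
    +-cancelˡ b {u} {v} = ∙-cancelˡ b u v
      where open GroupProperties +-group using (∙-cancelˡ)

  Slice⇒Admissible : ∀ {c x y z} → Slice c (x , y , z) → Admissible c x
  Slice⇒Admissible ((on , _) , z≈c) = OnSurface⇒Admissible (OnSurface-cong (refl , refl , z≈c) on)

  Card-slice : ∀ {c m} → ¬ c ≈ 0# → Card (Admissible c) m → CP.Card (Slice c) (m ℕ.* p)
  Card-slice c≉0 card = Card-bundle pointSetoid setoid proj₁ proj₁ Slice⇒Admissible card (Card-fibre c≉0)

  Nonzero : Pred Carrier ℓ₁
  Nonzero z = ¬ z ≈ 0#

  Card-nonzero : ∀ {r} {P : Pred Carrier r} {m} → P 0# → Card P m → Card (λ x → P x × Nonzero x) (m ∸ 1)
  Card-nonzero P0 card = Card-complement (_≟ 0#) (λ x≈y → trans (sym x≈y)) card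
    (Card-singleton (P0 , refl) proj₂)

  Card-units : Card Nonzero (p ℕ.^ 2 ∸ 1)
  Card-units = Card-cong proj₂ (tt ,_) (Card-nonzero tt Card-field)

  -- An element that is fixed by Frobenius and has trace zero satisfies 2z = 0, so the two sets of
  -- size p share only 0. Without it they are disjoint and contribute p - 1 elements each.
  Card-special-units : Card (Nonzero ∩ Special) ((p ∸ 1) ℕ.+ (p ∸ 1))
  Card-special-units = Card-⊎
    {P = λ z → InPrimeField z × Nonzero z} {Q = λ z → TraceZero z × Nonzero z}
    (λ (k , z≉0) → z≉0 , inj₁ k) (λ (t , z≉0) → z≉0 , inj₂ t)
    (λ { (z≉0 , inj₁ k) → inj₁ (k , z≉0) ; (z≉0 , inj₂ t) → inj₂ (t , z≉0) })
    disjoint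
    (Card-nonzero 0^p≈0 Card-primeField)
    (Card-nonzero (trans (+-identityˡ _) 0^p≈0) Card-traceZero)
    where
    disjoint : ∀ {x y} → InPrimeField x × Nonzero x → TraceZero y × Nonzero y → ¬ x ≈ y
    disjoint {x} {y} (k , x≉0) (t , _) x≈y = *-nonzero (k·1≉0 (s≤s z≤n) 2<p) x≉0 (begin
      (1# + (1# + 0#)) * x      ≈⟨ trans (distribʳ x 1# (1# + 0#)) (+-cong (*-identityˡ x) (trans (*-congʳ (+-identityʳ 1#)) (*-identityˡ x))) ⟩
      x + x                     ≈⟨ +-congˡ k ⟨
      x + x ^ p                 ≈⟨ +-cong x≈y (^-congˡ p x≈y) ⟩
      y + y ^ p                 ≈⟨ t ⟩
      0#                        ∎)

  Card-generic-units : Card (Nonzero ∩ ∁ Special) ((p ℕ.^ 2 ∸ 1) ∸ ((p ∸ 1) ℕ.+ (p ∸ 1)))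
  Card-generic-units = Card-complement special? Special-cong Card-units Card-special-units

  third : Point → Carrier
  third (_ , _ , z) = z

  -- There are 2(p - 1) special values of z with p values of x each; every other unit z has 2p - 1
  -- values of x. Over each admissible x lie p values of y.
  surfaceCount : ℕ
  surfaceCount = ((p ∸ 1) ℕ.+ (p ∸ 1)) ℕ.* (p ℕ.* p)
    ℕ.+ ((p ℕ.^ 2 ∸ 1) ∸ ((p ∸ 1) ℕ.+ (p ∸ 1))) ℕ.* ((p ℕ.+ (p ∸ 1)) ℕ.* p)

  Card-T : CP.Card InT surfaceCount
  Card-T = CP.Card-⊎ {P = λ P → InT P × Special (third P)} {Q = λ P → InT P × ¬ Special (third P)}
    proj₁ proj₁ split (λ (_ , s) (_ , ¬s) (_ , _ , z≈) → ¬s (Special-cong z≈ s))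
    (over special? Special-cong Card-special-units
      λ c (c≉0 , s) → Card-slice c≉0 (Card-admissible-special c≉0 s))
    (over (λ z → ¬? (special? z)) (λ x≈y ¬s s → ¬s (Special-cong (sym x≈y) s)) Card-generic-units
      λ c (c≉0 , ¬s) → Card-slice c≉0 (Card-admissible-generic c≉0 ¬s))
    where
    split : ∀ {P} → InT P → (InT P × Special (third P)) ⊎ (InT P × ¬ Special (third P))
    split {P} P∈ with special? (third P)
    ... | yes s = inj₁ (P∈ , s)
    ... | no ¬s = inj₂ (P∈ , ¬s)
    over : ∀ {r} {R : Pred Carrier r} → Decidable R → (∀ {x y} → x ≈ y → R x → R y) →
      ∀ {m k} → Card (Nonzero ∩ R) m → (∀ c → (Nonzero ∩ R) c → CP.Card (Slice c) k) →
      CP.Card (λ P → InT P × R (third P)) (m ℕ.* k)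
    over R? R-cong base slices = Card-bundle pointSetoid setoid third (λ (_ , _ , z≈) → z≈)
      (λ ((_ , z≉0) , r) → z≉0 , r) base
      λ c (c≉0 , r) → CP.Card-cong (λ (P∈ , z≈c) → (P∈ , R-cong (sym z≈c) r) , z≈c)
        (λ ((P∈ , _) , z≈c) → P∈ , z≈c) (slices c (c≉0 , r))

  Fiber⇒FibreOver : ∀ {Q} → InT Q → ∀ {P} → Fiber Q P → FibreOver (third Q) (proj₁ Q) P
  Fiber⇒FibreOver (on , z≉0) (k , eq@(x≈ , y≈ , z≈)) =
    (InT-cong (sym x≈ , sym y≈ , sym z≈) (shift-surface (k·1∈primeField (toℕ k)) on , z≉0) , z≈) , x≈

  FibreOver⇒Fiber : ∀ {Q} → InT Q → ∀ {P} → FibreOver (third Q) (proj₁ Q) P → Fiber Q P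
  FibreOver⇒Fiber {a , b , c} (on , _) {x , y , z} (((on′ , _) , z≈c) , x≈a)
    with k , y-b≈k ← primeField⇒multiple (difference∈primeField on (OnSurface-cong (x≈a , refl , z≈c) on′)) =
    k , x≈a , trans (sym (b+[y-b]≈y b y)) (+-congˡ y-b≈k) , z≈c

-- Arithmetic of the closed formulas

module Arithmetic where

  open ≡ using (cong; sym; trans; refl)

  private
    units : ∀ m → (2 ℕ.+ m) ℕ.^ 2 ∸ 1 ∸ ((1 ℕ.+ m) ℕ.+ (1 ℕ.+ m)) ≡ (1 ℕ.+ m) ℕ.* (1 ℕ.+ m)
    units m = trans (cong (λ k → k ∸ 1 ∸ ((1 ℕ.+ m) ℕ.+ (1 ℕ.+ m))) (expand m))
      (ℕₚ.m+n∸m≡n ((1 ℕ.+ m) ℕ.+ (1 ℕ.+ m)) ((1 ℕ.+ m) ℕ.* (1 ℕ.+ m)))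
      where
      open +-*-Solver
      expand : ∀ m → (2 ℕ.+ m) ℕ.^ 2 ≡ 1 ℕ.+ (((1 ℕ.+ m) ℕ.+ (1 ℕ.+ m)) ℕ.+ (1 ℕ.+ m) ℕ.* (1 ℕ.+ m))
      expand = solve 1 (λ m → (con 2 :+ m) :^ 2 :=
        con 1 :+ (((con 1 :+ m) :+ (con 1 :+ m)) :+ (con 1 :+ m) :* (con 1 :+ m))) refl

  -- Each truncated subtraction is resolved by writing its minuend as subtrahend plus remainder.
  -- With p = 2 + m these decompositions are polynomial identities in m.
  count-identity : ∀ p → 1 < p →
    ((p ∸ 1) ℕ.+ (p ∸ 1)) ℕ.* (p ℕ.* p)
      ℕ.+ ((p ℕ.^ 2 ∸ 1) ∸ ((p ∸ 1) ℕ.+ (p ∸ 1))) ℕ.* ((p ℕ.+ (p ∸ 1)) ℕ.* p)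
    ≡ 2 ℕ.* p ℕ.^ 4 ∸ 3 ℕ.* p ℕ.^ 3 ℕ.+ 2 ℕ.* p ℕ.^ 2 ∸ p
  count-identity p@(suc (suc m)) (s≤s (s≤s _)) = begin
    a ℕ.+ (p ℕ.^ 2 ∸ 1 ∸ ((1 ℕ.+ m) ℕ.+ (1 ℕ.+ m))) ℕ.* b
      ≡⟨ cong (λ k → a ℕ.+ k ℕ.* b) (units m) ⟩
    a ℕ.+ (1 ℕ.+ m) ℕ.* (1 ℕ.+ m) ℕ.* b
      ≡⟨ ℕₚ.m+n∸m≡n p _ ⟨
    p ℕ.+ (a ℕ.+ (1 ℕ.+ m) ℕ.* (1 ℕ.+ m) ℕ.* b) ∸ p
      ≡⟨ cong (_∸ p) (total m) ⟨
    p ℕ.^ 3 ℕ.* (1 ℕ.+ (m ℕ.+ m)) ℕ.+ 2 ℕ.* p ℕ.^ 2 ∸ p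
      ≡⟨ cong (λ k → k ℕ.+ 2 ℕ.* p ℕ.^ 2 ∸ p) (trans (cong (_∸ 3 ℕ.* p ℕ.^ 3) (quartic m)) (ℕₚ.m+n∸m≡n (3 ℕ.* p ℕ.^ 3) _)) ⟨
    2 ℕ.* p ℕ.^ 4 ∸ 3 ℕ.* p ℕ.^ 3 ℕ.+ 2 ℕ.* p ℕ.^ 2 ∸ p ∎
    where
    open ≡.≡-Reasoning
    open +-*-Solver
    a = ((1 ℕ.+ m) ℕ.+ (1 ℕ.+ m)) ℕ.* (p ℕ.* p)
    b = (p ℕ.+ (1 ℕ.+ m)) ℕ.* p
    quartic : ∀ m → let p = 2 ℕ.+ m in 2 ℕ.* p ℕ.^ 4 ≡ 3 ℕ.* p ℕ.^ 3 ℕ.+ p ℕ.^ 3 ℕ.* (1 ℕ.+ (m ℕ.+ m))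
    quartic = solve 1 (λ m → let p = con 2 :+ m in
      con 2 :* p :^ 4 := con 3 :* p :^ 3 :+ p :^ 3 :* (con 1 :+ (m :+ m))) refl
    total : ∀ m → let p = 2 ℕ.+ m in p ℕ.^ 3 ℕ.* (1 ℕ.+ (m ℕ.+ m)) ℕ.+ 2 ℕ.* p ℕ.^ 2 ≡
      p ℕ.+ (((1 ℕ.+ m) ℕ.+ (1 ℕ.+ m)) ℕ.* (p ℕ.* p) ℕ.+ (1 ℕ.+ m) ℕ.* (1 ℕ.+ m) ℕ.* ((p ℕ.+ (1 ℕ.+ m)) ℕ.* p))
    total = solve 1 (λ m → let p = con 2 :+ m; p-1 = con 1 :+ m in
      p :^ 3 :* (con 1 :+ (m :+ m)) :+ con 2 :* p :^ 2 :=
      p :+ ((p-1 :+ p-1) :* (p :* p) :+ p-1 :* p-1 :* ((p :+ p-1) :* p))) refl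

  slice-size : ∀ p → (p ℕ.+ (p ∸ 1)) ℕ.* p ≤ 2 ℕ.* p ℕ.^ 2 ∸ p
  slice-size zero = z≤n
  slice-size p@(suc m) = ℕₚ.≤-reflexive (sym (trans (cong (_∸ p) (expand m)) (ℕₚ.m+n∸m≡n p _)))
    where
    open +-*-Solver
    expand : ∀ m → let p = suc m in 2 ℕ.* p ℕ.^ 2 ≡ p ℕ.+ (p ℕ.+ m) ℕ.* p
    expand = solve 1 (λ m → let p = con 1 :+ m in con 2 :* p :^ 2 := p :+ (p :+ m) :* p) refl

  points-degree : ∀ {m n} → n ≤ m → n ℕ.+ (m ∸ n ℕ.+ 1) ≡ suc m
  points-degree {m} {n} n≤m = trans (sym (ℕₚ.+-assoc n (m ∸ n) 1))
    (trans (cong (ℕ._+ 1) (ℕₚ.m+[n∸m]≡n n≤m)) (ℕₚ.+-comm m 1))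

  -- This is an equality: the p² - 1 units exceed the degree p² - 2p in z by 2p - 1. The number of
  -- x-coordinates in a generic slice has the same value for a different reason.
  third-degree : ∀ p → 1 < p → p ℕ.+ (p ∸ 1) ℕ.+ (p ℕ.^ 2 ∸ 2 ℕ.* p ℕ.+ 1) ≤ suc (p ℕ.^ 2 ∸ 1)
  third-degree p@(suc (suc m)) (s≤s (s≤s _)) = ℕₚ.≤-reflexive (begin
    p ℕ.+ suc m ℕ.+ (p ℕ.^ 2 ∸ 2 ℕ.* p ℕ.+ 1)   ≡⟨ shuffle p (suc m) (p ℕ.^ 2 ∸ 2 ℕ.* p) ⟩
    p ℕ.+ (1 ℕ.+ suc m) ℕ.+ (p ℕ.^ 2 ∸ 2 ℕ.* p) ≡⟨ cong (λ k → p ℕ.+ k ℕ.+ (p ℕ.^ 2 ∸ 2 ℕ.* p)) (sym (ℕₚ.+-identityʳ p)) ⟩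
    2 ℕ.* p ℕ.+ (p ℕ.^ 2 ∸ 2 ℕ.* p)             ≡⟨ ℕₚ.m+[n∸m]≡n 2p≤p² ⟩
    p ℕ.^ 2                                     ≡⟨⟩
    suc (p ℕ.^ 2 ∸ 1)                           ∎)
    where
    open ≡.≡-Reasoning
    2p≤p² : 2 ℕ.* p ≤ p ℕ.^ 2
    2p≤p² = ≡.subst (2 ℕ.* p ≤_) (cong (p ℕ.*_) (sym (ℕₚ.*-identityʳ p))) (ℕₚ.*-monoˡ-≤ p {2} {p} (s≤s (s≤s z≤n)))
    open +-*-Solver
    shuffle : ∀ a b c → a ℕ.+ b ℕ.+ (c ℕ.+ 1) ≡ a ℕ.+ (1 ℕ.+ b) ℕ.+ c
    shuffle = solve 3 (λ a b c → a :+ b :+ (c :+ con 1) := a :+ (con 1 :+ b) :+ c) refl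

  sum≤product : ∀ {m n} → 2 ≤ m → 2 ≤ n → m ℕ.+ n ≤ m ℕ.* n
  sum≤product {suc (suc m)} {suc (suc n)} (s≤s (s≤s _)) (s≤s (s≤s _)) =
    ℕₚ.≤-trans (ℕₚ.m≤m+n _ (m ℕ.+ n ℕ.+ m ℕ.* n)) (ℕₚ.≤-reflexive (expand m n))
    where
    open +-*-Solver
    expand : ∀ m n → (2 ℕ.+ m) ℕ.+ (2 ℕ.+ n) ℕ.+ (m ℕ.+ n ℕ.+ m ℕ.* n) ≡ (2 ℕ.+ m) ℕ.* (2 ℕ.+ n)
    expand = solve 2 (λ m n → (con 2 :+ m) :+ (con 2 :+ n) :+ (m :+ n :+ m :* n) := (con 2 :+ m) :* (con 2 :+ n)) refl

  -- With r = ρ₁ + ρ₂, dropping the 3 gives at most rp + r ≤ rp + (p - 1)r = (2p - 1)r, and r ≤ ρ₁ρ₂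
  -- since both factors are at least 2.
  distance-bound : ∀ p ρ₁ ρ₂ → 1 < p → 2 ≤ ρ₁ → 2 ≤ ρ₂ →
    (ρ₁ ℕ.+ ρ₂ ∸ 3) ℕ.* p ℕ.+ (ρ₁ ℕ.+ ρ₂) ≤ (p ℕ.+ (p ∸ 1)) ℕ.* (ρ₁ ℕ.* ρ₂)
  distance-bound p@(suc (suc m)) ρ₁ ρ₂ (s≤s (s≤s _)) 2≤ρ₁ 2≤ρ₂ = begin
    (r ∸ 3) ℕ.* p ℕ.+ r                      ≤⟨ ℕₚ.+-mono-≤ (ℕₚ.*-monoˡ-≤ p (ℕₚ.m∸n≤m r 3)) (ℕₚ.m≤m+n r (m ℕ.* r)) ⟩
    r ℕ.* p ℕ.+ suc m ℕ.* r                  ≡⟨ cong (ℕ._+ suc m ℕ.* r) (ℕₚ.*-comm r p) ⟩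
    p ℕ.* r ℕ.+ suc m ℕ.* r                  ≡⟨ ℕₚ.*-distribʳ-+ r p (suc m) ⟨
    (p ℕ.+ suc m) ℕ.* r                      ≤⟨ ℕₚ.*-monoʳ-≤ (p ℕ.+ suc m) (sum≤product 2≤ρ₁ 2≤ρ₂) ⟩
    (p ℕ.+ suc m) ℕ.* (ρ₁ ℕ.* ρ₂)            ∎
    where
    open ℕₚ.≤-Reasoning
    r = ρ₁ ℕ.+ ρ₂

-- Weights of the monomials on the surface, and the codes

module SurfaceCode {c ℓ₁ ℓ₂ : Level} (p : ℕ) (p-prime : Prime p) (2∤p : 2 ∤ p)
  (F : FiniteField c ℓ₁ ℓ₂ (p ℕ.^ 2))
  (ρ₁ ρ₂ : ℕ) (2≤ρ₁ : 2 ≤ ρ₁) (ρ₁≤p : ρ₁ ≤ p) (2≤ρ₂ : 2 ≤ ρ₂) (ρ₂≤p : ρ₂ ≤ p) where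

  open Field F
  open PrimeSquareFields p p-prime 2∤p F
  open Codes F
  open Evaluation F
  open Surface p F
  open SurfacePoints p p-prime 2∤p F
  open Weights F
  open EvaluationCodes F
  open Arithmetic
  open Bundle using (Card-map)
  open SetoidReasoning setoid

  s-x s-y s-z : ℕ
  s-x = p ∸ ρ₁ ℕ.+ 1
  s-y = p ∸ ρ₂ ℕ.+ 1
  s-z = p ℕ.^ 2 ∸ 2 ℕ.* p ℕ.+ 1

  exponent≤ : ∀ {n} (i : Fin (n ℕ.+ 1)) → toℕ i ≤ n
  exponent≤ {n} i = ℕₚ.≤-pred (≡.subst (toℕ i <_) (ℕₚ.+-comm n 1) (toℕ<n i))

  exponent : ∀ {k n} → k ≤ n → ∃ λ (i : Fin (n ℕ.+ 1)) → toℕ i ≡ k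
  exponent {k} {n} k≤n = fromℕ< k<n+1 , toℕ-fromℕ< k<n+1
    where
    k<n+1 = ≡.subst (k <_) (ℕₚ.+-comm 1 n) (s≤s k≤n)

  setZ : ℕ → Monomial → Monomial
  setZ k (i , j , _) = i , j , k

  mon-y : Fin s-y → Monomial
  mon-y j = 0 , toℕ j , 0

  -- The index of y is the outer one because `bundle-weight` puts the fibre index before the base
  -- index; in `mon-xyz` the pair likewise precedes z.
  mon-xy : Fin (s-y ℕ.* s-x) → Monomial
  mon-xy m = let j , i = remQuot {s-y} s-x m in toℕ i , toℕ j , 0

  mon-xyz : Fin (s-y ℕ.* s-x ℕ.* s-z) → Monomial
  mon-xyz m = let ij , k = remQuot {s-y ℕ.* s-x} s-z m in setZ (toℕ k) (mon-xy ij)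

  mon-xy-combine : ∀ (j : Fin s-y) (i : Fin s-x) → mon-xy (combine j i) ≡ (toℕ i , toℕ j , 0)
  mon-xy-combine j i = ≡.cong (λ (j , i) → toℕ i , toℕ j , 0) (remQuot-combine j i)

  mon-xyz-combine : ∀ (ij : Fin (s-y ℕ.* s-x)) (k : Fin s-z) → mon-xyz (combine ij k) ≡ setZ (toℕ k) (mon-xy ij)
  mon-xyz-combine ij k = ≡.cong (λ (ij , k) → setZ (toℕ k) (mon-xy ij)) (remQuot-combine ij k)

  mon-xyz-surjective : ∀ {i j k} → VMonomial ρ₁ ρ₂ (i , j , k) → ∃ λ m → mon-xyz m ≡ (i , j , k)
  mon-xyz-surjective (i≤ , j≤ , k≤)
    with i , ≡.refl ← exponent i≤ | j , ≡.refl ← exponent j≤ | k , ≡.refl ← exponent k≤ =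
    combine (combine j i) k ,
    ≡.trans (mon-xyz-combine (combine j i) k) (≡.cong (setZ (toℕ k)) (mon-xy-combine j i))

  mon-xyz∈V : ∀ m → VMonomial ρ₁ ρ₂ (mon-xyz m)
  mon-xyz∈V m = let ij , k = remQuot {s-y ℕ.* s-x} s-z m; j , i = remQuot {s-y} s-x ij in
    exponent≤ i , exponent≤ j , exponent≤ k

  Weight-mono : ∀ {r} {P : Pred Point r} {s} {φ ψ : Fin s → Point → Carrier} → (∀ j P → φ j P ≈ ψ j P) →
    ∀ {d e} → d ≤ e → Weight pointSetoid P φ e → Weight pointSetoid P ψ d
  Weight-mono {φ = φ} {ψ} φ≈ψ d≤e weight a j aj≉0 = CP.AtLeast-≤ d≤e (CP.AtLeast-mono
    (λ {P} (P∈ , ≉0) → P∈ , λ eq → ≉0 (trans (sum-cong {f = λ j → a j * φ j P} (λ j → *-congˡ (φ≈ψ j P))) eq))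
    (weight a j aj≉0))
    where open LinearCombinations F

  -- On a fibre x and z are constant, so y separates its p points, while there are p - ρ₂ + 1 powers
  -- of y.
  fibre-weight : ∀ {c a} → ¬ c ≈ 0# → Admissible c a → Weight pointSetoid (FibreOver c a) (λ j → evalMonomial (mon-y j)) ρ₂
  fibre-weight {c} {a} c≉0 adm = Weight-mono
    (λ j (x , y , z) → sym (trans (*-identityʳ _) (*-identityˡ _))) ℕₚ.≤-refl
    (power-weight pointSetoid (λ (_ , y , _) → y) (λ (_ , y≈ , _) → y≈) fibre
      (λ {i} {j} y≈ → CP.AtLeast.injective fibre
        (let (_ , z≈c) , x≈a = CP.AtLeast.member fibre i; (_ , z′≈c) , x′≈a = CP.AtLeast.member fibre j in
         trans x≈a (sym x′≈a) , y≈ , trans z≈c (sym z′≈c)))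
      (ℕₚ.≤-reflexive (points-degree ρ₂≤p)))
    where fibre = CP.Card.atLeast (Card-fibre c≉0 a adm)

  slice-weight : ∀ {c} → ¬ c ≈ 0# → Weight pointSetoid (Slice c) (λ m → evalMonomial (mon-xy m)) (ρ₁ ℕ.* ρ₂)
  slice-weight {c} c≉0 = bundle-weight pointSetoid setoid proj₁ proj₁ {d = ρ₁} {e = ρ₂}
    (λ j → evalMonomial (mon-y j)) (λ i x → x ^ toℕ i) (λ m → evalMonomial (mon-xy m)) product
    (power-weight setoid id id lines (Counting.AtLeast.injective lines) {s-x} {ρ₁} (ℕₚ.≤-reflexive (points-degree ρ₁≤p)))
    λ a adm → fibre-weight c≉0 adm
    where
    lines = AtLeast-admissible c≉0
    product : ∀ (j : Fin s-y) (i : Fin s-x) {P a} → proj₁ P ≈ a →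
      evalMonomial (mon-xy (combine j i)) P ≈ evalMonomial (mon-y j) P * a ^ toℕ i
    product j i {P@(x , y , z)} {a} x≈a = begin
      evalMonomial (mon-xy (combine j i)) P         ≡⟨ ≡.cong (λ m → evalMonomial m P) (mon-xy-combine j i) ⟩
      x ^ toℕ i * y ^ toℕ j * 1#                    ≈⟨ *-congʳ (*-congʳ (^-congˡ (toℕ i) x≈a)) ⟩
      a ^ toℕ i * y ^ toℕ j * 1#                    ≈⟨ solve 2 (λ a y → a :* y :* con 1 := con 1 :* y :* con 1 :* a) refl (a ^ toℕ i) (y ^ toℕ j) ⟩
      1# * y ^ toℕ j * 1# * a ^ toℕ i               ∎
      where open CSolver

  full-weight : Weight pointSetoid InT (λ m → evalMonomial (mon-xyz m)) ((p ℕ.+ (p ∸ 1)) ℕ.* (ρ₁ ℕ.* ρ₂))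
  full-weight = bundle-weight pointSetoid setoid third (λ (_ , _ , z≈) → z≈) {d = p ℕ.+ (p ∸ 1)} {e = ρ₁ ℕ.* ρ₂}
    (λ m → evalMonomial (mon-xy m)) (λ k z → z ^ toℕ k) (λ m → evalMonomial (mon-xyz m)) product
    (power-weight setoid id id units (Counting.AtLeast.injective units) {s-z} {p ℕ.+ (p ∸ 1)} (third-degree p 1<p))
    λ c c≉0 → slice-weight c≉0
    where
    units = Counting.Card.atLeast Card-units
    product : ∀ (ij : Fin (s-y ℕ.* s-x)) (k : Fin s-z) {P c} → third P ≈ c →
      evalMonomial (mon-xyz (combine ij k)) P ≈ evalMonomial (mon-xy ij) P * c ^ toℕ k
    product ij k {P@(x , y , z)} {c} z≈c = begin
      evalMonomial (mon-xyz (combine ij k)) P       ≡⟨ ≡.cong (λ m → evalMonomial m P) (mon-xyz-combine ij k) ⟩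
      x ^ i * y ^ j * z ^ toℕ k                     ≈⟨ *-cong (sym (*-identityʳ _)) (^-congˡ (toℕ k) z≈c) ⟩
      x ^ i * y ^ j * 1# * c ^ toℕ k                ∎
      where
      i = proj₁ (mon-xy ij)
      j = proj₁ (proj₂ (mon-xy ij))

  constant-y : ∀ {i j k x y z a c} → x ≈ a → z ≈ c →
    evalMonomial (i , j , k) (x , y , z) ≈ a ^ i * c ^ k * evalMonomial (0 , j , 0) (x , y , z)
  constant-y {i} {j} {k} {x} {y} {z} {a} {c} x≈a z≈c = begin
    x ^ i * y ^ j * z ^ k                 ≈⟨ *-cong (*-congʳ (^-congˡ i x≈a)) (^-congˡ k z≈c) ⟩
    a ^ i * y ^ j * c ^ k                 ≈⟨ solve 3 (λ a y c → a :* y :* c := a :* c :* (con 1 :* y :* con 1)) refl (a ^ i) (y ^ j) (c ^ k) ⟩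
    a ^ i * c ^ k * (1# * y ^ j * 1#)     ∎
    where open CSolver

  constant-z : ∀ {i j k x y z c} → z ≈ c →
    evalMonomial (i , j , k) (x , y , z) ≈ c ^ k * evalMonomial (i , j , 0) (x , y , z)
  constant-z {i} {j} {k} {x} {y} {z} {c} z≈c = begin
    x ^ i * y ^ j * z ^ k                 ≈⟨ *-congˡ (^-congˡ k z≈c) ⟩
    x ^ i * y ^ j * c ^ k                 ≈⟨ solve 3 (λ x y c → x :* y :* c := c :* (x :* y :* con 1)) refl (x ^ i) (y ^ j) (c ^ k) ⟩
    c ^ k * (x ^ i * y ^ j * 1#)          ∎
    where open CSolver

  1≤ρ₂ : 1 ≤ ρ₂
  1≤ρ₂ = ℕₚ.<⇒≤ 2≤ρ₂

  1≤ρ₁ρ₂ : 1 ≤ ρ₁ ℕ.* ρ₂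
  1≤ρ₁ρ₂ = ℕₚ.*-mono-≤ {1} {ρ₁} {1} {ρ₂} (ℕₚ.<⇒≤ 2≤ρ₁) 1≤ρ₂

  index-y : Fin s-y
  index-y = proj₁ (exponent z≤n)

  index-xy : Fin (s-y ℕ.* s-x)
  index-xy = combine index-y (proj₁ (exponent z≤n))

  index-xyz : Fin (s-y ℕ.* s-x ℕ.* s-z)
  index-xyz = combine index-xy (proj₁ (exponent z≤n))

  module _ (n : ℕ) (o : Ordering n) where

    pts : Vector Point n
    pts = points o

    C : Code n
    C = evaluationCode (V ρ₁ ρ₂) pts

    pts∈T : ∀ i → InT (pts i)
    pts∈T i = proj₂ (Inverse.to o i)

    -- The ordering is a bijection between positions and points of T, so the lengths of the codes
    -- become cardinalities already known for the surface.
    Card-ordering : ∀ {r} {S : Pred Point r} → (∀ {P Q} → P ≈ₚ Q → S P → S Q) →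
      ∀ {m} → CountFin.Card (λ i → S (pts i)) m → CP.Card (InT ∩ S) m
    Card-ordering S-cong = Card-map (≡.setoid (Fin n)) pointSetoid pts
      (λ {i} s → pts∈T i , s)
      (λ {i} {j} eq → ≡.trans (≡.sym (Inverse.strictlyInverseʳ o i))
        (≡.trans (Inverse.from-cong o eq) (Inverse.strictlyInverseʳ o j)))
      (λ { {Q} (Q∈ , s) → let Q≈ = Setoid.sym pointSetoid (Inverse.strictlyInverseˡ o (Q , Q∈)) in
        Inverse.from o (Q , Q∈) , S-cong Q≈ s , Q≈ })
      (λ { ≡.refl → Setoid.refl pointSetoid })

    at-position : ∀ {Q} → InT Q → ∃ λ i → Q ≈ₚ pts i
    at-position Q∈ = Inverse.from o (_ , Q∈) , Setoid.sym pointSetoid (Inverse.strictlyInverseˡ o (_ , Q∈))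

    at-selected : ∀ {r} {S : Pred Point r} → (∀ {P Q} → P ≈ₚ Q → S P → S Q) →
      (S? : Decidable (λ i → S (pts i))) → ∀ {Q} → InT Q → S Q → ∃ λ k → Q ≈ₚ pts (lookup (positions S?) k)
    at-selected S-cong S? Q∈ s with i , Q≈ ← at-position Q∈
      with k , ≡.refl ← CountFin.Card.complete (CountFin.filter-Card S?) (S-cong Q≈ s) = k , Q≈

    selected : ∀ {r} {S : Pred Point r} (S? : Decidable (λ i → S (pts i))) →
      ∀ k → S (pts (lookup (positions S?) k))
    selected S? k = CountFin.Card.member (CountFin.filter-Card S?) k

    SameZ-cong : ∀ {Q P P′} → P ≈ₚ P′ → SameZ Q P → SameZ Q P′
    SameZ-cong (_ , _ , z≈) eq = trans (sym z≈) eq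

    Fiber-cong : ∀ {Q P P′} → P ≈ₚ P′ → Fiber Q P → Fiber Q P′
    Fiber-cong P≈ (k , eq) = k , Setoid.trans pointSetoid (Setoid.sym pointSetoid P≈) eq

    length-lower : ∀ i → length (positions (lower? o i)) ≡ p
    length-lower i with pts i in eq | pts∈T i
    ... | Q@(a , b , c) | Q∈@(on , c≉0) = CP.Card-unique
      (λ (_ , f) → Fiber⇒FibreOver Q∈ f)
      (λ f → proj₁ (proj₁ f) , FibreOver⇒Fiber Q∈ f)
      (Card-ordering {S = Fiber Q} Fiber-cong (CountFin.filter-Card λ j → fiber? Q (pts j)))
      (Card-fibre c≉0 a (OnSurface⇒Admissible on))

    length-middle : ∀ i → length (positions (middle? o i)) ≤ 2 ℕ.* p ℕ.^ 2 ∸ p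
    length-middle i = ℕₚ.≤-trans (bound (special? z)) (slice-size p)
      where
      z = third (pts i)
      z≉0 = proj₂ (pts∈T i)
      count : ∀ {m} → Counting.Card setoid (Admissible z) m → length (positions (middle? o i)) ≡ m ℕ.* p
      count adm = CP.Card-unique id id
        (Card-ordering {S = SameZ (pts i)} (SameZ-cong {pts i}) (CountFin.filter-Card (middle? o i))) (Card-slice z≉0 adm)
      bound : Dec (Special z) → length (positions (middle? o i)) ≤ (p ℕ.+ (p ∸ 1)) ℕ.* p
      bound (yes s) = ℕₚ.≤-trans (ℕₚ.≤-reflexive (count (Card-admissible-special z≉0 s)))
        (ℕₚ.*-monoˡ-≤ p (ℕₚ.m≤m+n p (p ∸ 1)))
      bound (no ¬s) = ℕₚ.≤-reflexive (count (Card-admissible-generic z≉0 ¬s))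

    length-full : n ≡ 2 ℕ.* p ℕ.^ 4 ∸ 3 ℕ.* p ℕ.^ 3 ℕ.+ 2 ℕ.* p ℕ.^ 2 ∸ p
    length-full = ≡.trans (CP.Card-unique proj₁ (λ Q∈ → Q∈ , tt) (Card-ordering (λ _ → id) all) Card-T)
      (count-identity p 1<p)
      where
      all : CountFin.Card (λ _ → ⊤) n
      all = CountFin.mkCard (CountFin.mkAtLeast id (λ _ → tt) id) (λ {i} _ → i , ≡.refl)

    -- On the fibre every monomial of `V` is a constant times a power of y, and all powers up to p -
    -- ρ₂ occur in `V` itself; the dimension is therefore exactly `s-y`.
    parameters-lower : ∀ i → HasDimension (puncture C (lower? o i)) s-y
                           × MinimumDistanceAtLeast (puncture C (lower? o i)) ρ₂
    parameters-lower i = evaluationCode-parameters {M = VMonomial ρ₁ ρ₂} (pts ∘ lookup (positions (lower? o i))) mon-y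
      (λ j → z≤n , exponent≤ j , z≤n)
      reduce
      (λ f → at-selected {S = Fiber (pts i)} Fiber-cong (lower? o i) (proj₁ (proj₁ f)) (FibreOver⇒Fiber (pts∈T i) f))
      (fibre-weight (proj₂ (pts∈T i)) (OnSurface⇒Admissible (proj₁ (pts∈T i))))
      1≉0 1≤ρ₂ index-y _
      (puncture⊆evaluationCode (lower? o i)) (evaluationCode⊆puncture (lower? o i))
      where
      reduce : ∀ m → VMonomial ρ₁ ρ₂ m → ∃ λ κ → ∃ λ j → ∀ k →
        let P = pts (lookup (positions (lower? o i)) k) in evalMonomial m P ≈ κ * evalMonomial (mon-y j) P
      reduce (e , f , g) (_ , f≤ , _) with j , ≡.refl ← exponent f≤ =
        proj₁ (pts i) ^ e * third (pts i) ^ g , j , λ k →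
          let _ , x≈ , _ , z≈ = selected {S = Fiber (pts i)} (lower? o i) k in constant-y {e} {toℕ j} {g} x≈ z≈

    parameters-middle : ∀ i → HasDimension (puncture C (middle? o i)) (s-y ℕ.* s-x)
                            × MinimumDistanceAtLeast (puncture C (middle? o i)) (ρ₁ ℕ.* ρ₂)
    parameters-middle i = evaluationCode-parameters {M = VMonomial ρ₁ ρ₂} (pts ∘ lookup (positions (middle? o i))) mon-xy
      (λ m → let j , i = remQuot {s-y} s-x m in exponent≤ i , exponent≤ j , z≤n)
      reduce
      (λ (Q∈ , z≈) → at-selected {S = SameZ (pts i)} (SameZ-cong {pts i}) (middle? o i) Q∈ z≈)
      (slice-weight (proj₂ (pts∈T i)))
      1≉0 1≤ρ₁ρ₂ index-xy _
      (puncture⊆evaluationCode (middle? o i)) (evaluationCode⊆puncture (middle? o i))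
      where
      reduce : ∀ m → VMonomial ρ₁ ρ₂ m → ∃ λ κ → ∃ λ j → ∀ k →
        let P = pts (lookup (positions (middle? o i)) k) in evalMonomial m P ≈ κ * evalMonomial (mon-xy j) P
      reduce (e , f , g) (e≤ , f≤ , _) with l , ≡.refl ← exponent e≤ | j , ≡.refl ← exponent f≤ =
        -- On the slice z is constant, so its power is the scalar and only the exponents of x and y
        -- choose the index.
        third (pts i) ^ g , combine j l , λ k →
          let P = pts (lookup (positions (middle? o i)) k) in
          trans (constant-z {toℕ l} {toℕ j} {g} (selected {S = SameZ (pts i)} (middle? o i) k))
            (*-congˡ (reflexive (≡.cong (λ m → evalMonomial m P) (≡.sym (mon-xy-combine j l)))))

    parameters-full : HasDimension C (s-y ℕ.* s-x ℕ.* s-z)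
                    × MinimumDistanceAtLeast C ((ρ₁ ℕ.+ ρ₂ ∸ 3) ℕ.* p ℕ.+ (ρ₁ ℕ.+ ρ₂))
    parameters-full = evaluationCode-parameters {M = VMonomial ρ₁ ρ₂} pts mon-xyz mon-xyz∈V reduce at-position
      (Weight-mono (λ _ _ → refl) (distance-bound p ρ₁ ρ₂ 1<p 2≤ρ₁ 2≤ρ₂) full-weight)
      1≉0 (ℕₚ.≤-trans (ℕₚ.<⇒≤ 2≤ρ₁) (ℕₚ.≤-trans (ℕₚ.m≤m+n ρ₁ ρ₂) (ℕₚ.m≤n+m (ρ₁ ℕ.+ ρ₂) ((ρ₁ ℕ.+ ρ₂ ∸ 3) ℕ.* p)))) index-xyz C id id
      where
      reduce : ∀ m → VMonomial ρ₁ ρ₂ m → ∃ λ κ → ∃ λ j → ∀ i →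
        evalMonomial m (pts i) ≈ κ * evalMonomial (mon-xyz j) (pts i)
      reduce m m∈ with j , ≡.refl ← mon-xyz-surjective m∈ = 1# , j , λ i → sym (*-identityˡ _)

    locality : HierarchicalLocality C (middle? o) (lower? o) (2 ℕ.* p ℕ.^ 2 ∸ p) (s-y ℕ.* s-x) (ρ₁ ℕ.* ρ₂) p s-y ρ₂
    locality = record
      { ∈middle        = λ i → refl
      ; ∈lower         = λ i → FibreOver⇒Fiber (pts∈T i) ((pts∈T i , refl) , refl)
      ; nested         = λ j∈ (_ , _ , _ , z≈) → trans z≈ j∈
      ; middleLength   = length-middle
      ; middleDim      = λ i → _ , proj₁ (parameters-middle i) , ℕₚ.≤-refl
      ; middleDistance = λ i → proj₂ (parameters-middle i)
      ; lowerLength    = λ i → ℕₚ.≤-reflexive (length-lower i)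
      ; lowerDim       = λ i → _ , proj₁ (parameters-lower i) , ℕₚ.≤-refl
      ; lowerDistance  = λ i → proj₂ (parameters-lower i)
      }

open import Data.Nat using (_+_; _*_; _^_)

theorem4p4 :
    ∀ {c ℓ₁ ℓ₂ : Level} (p : ℕ) → Prime p → 2 ∤ p →
    (F : FiniteField c ℓ₁ ℓ₂ (p ^ 2)) →
    (ρ₁ ρ₂ : ℕ) → 2 ≤ ρ₁ → ρ₁ ≤ p → 2 ≤ ρ₂ → ρ₂ ≤ p →
    let open Codes F
        open Evaluation F
        open Surface p F
    in
    (n : ℕ) (o : Ordering n) →
    let C  = evaluationCode (V ρ₁ ρ₂) (points o)
        n₁ = 2 * p ^ 2 ∸ p
        s₁ = (p ∸ ρ₂ + 1) * (p ∸ ρ₁ + 1)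
        d₁ = ρ₁ * ρ₂
        n₂ = p
        s₂ = p ∸ ρ₂ + 1
        d₂ = ρ₂
    in
    HierarchicalLocality C (middle? o) (lower? o) n₁ s₁ d₁ n₂ s₂ d₂
    × (∀ i → length (positions (lower? o i)) ≡ n₂)
    × n ≡ 2 * p ^ 4 ∸ 3 * p ^ 3 + 2 * p ^ 2 ∸ p
    × HasDimension C ((p ∸ ρ₂ + 1) * (p ∸ ρ₁ + 1) * (p ^ 2 ∸ 2 * p + 1))
    × MinimumDistanceAtLeast C ((ρ₁ + ρ₂ ∸ 3) * p + (ρ₁ + ρ₂))
theorem4p4 p p-prime 2∤p F ρ₁ ρ₂ 2≤ρ₁ ρ₁≤p 2≤ρ₂ ρ₂≤p n o =
  locality n o , length-lower n o , length-full n o , proj₁ (parameters-full n o) , proj₂ (parameters-full n o)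
  where open SurfaceCode p p-prime 2∤p F ρ₁ ρ₂ 2≤ρ₁ ρ₁≤p 2≤ρ₂ ρ₂≤p
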